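{- Let $n \geq 2$, $m$, $\delta$ be integers with $\delta \geq n$ and $m \leq 2\delta-1$. Let $G$ be a bipartite graph with bipartition $(X,Y)$, where $|X| = n$, $|Y| = m$, and every $x \in X$ has degree at least $\delta$. If $G$ does not contain a cycle of length $2n$, then either $G$ is isomorphic to $G_1(n)$, or $G$ is isomorphic to $G_2(a,b)$ for some positive integers $a \geq b$ with $a+b=n$ (where $G_1(n)$ and $G_2(a,b)$ are the graphs defined in the context, with parameter $\delta$).
   Context: $G_1(n)$ (defined when $\delta = n$): take a copy of the complete bipartite graph $K_{\delta,\delta-1}$ with parts $X$ of size $\delta$ and $Y_0$ of size $\delta-1$, and for every vertex of $X$ add a new private neighbor of degree 1; the resulting graph has parts $X$ (size $n=\delta$) and $Y$ of size $2\delta-1$. $G_2(a,b)$ (for positive integers $a\ge b$ with $a+b=n$): take a copy $H_1$ of $K_{a,\delta}$ and a copy $H_2$ of $K_{b,\delta}$ and identify one vertex of $H_1$ in its part of size $\delta$ with one vertex of $H_2$ in its part of size $\delta$; here $X$ is the union of the parts of sizes $a$ and $b$ (so $|X|=n$) and $Y$ has size $2\delta-1$. -}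

module Defs where

open import Data.Empty using (⊥)
open import Data.Fin using (Fin; toℕ)
import Data.Fin as Fin
open import Data.Fin.Subset using (Subset; ∣_∣)
open import Data.Nat using (ℕ; suc; _∸_; _≤_)
open import Data.Sum using (_⊎_; inj₁; inj₂)
open import Data.Unit using (⊤; tt)
open import Data.Vec using (tabulate)
open import Function.Bundles using (_↔_; _⇔_; Inverse)
open import Function.Definitions using (Injective)
open import Relation.Binary.PropositionalEquality using (_≡_)
open import Relation.Nullary using (¬_; Dec; does; yes; no)

record Graph : Set₁ where
  infix 4 _~_
  field
    Vertex   : Set
    _~_      : Vertex → Vertex → Set
    ~-sym    : ∀ {u v} → u ~ v → v ~ u
    ~-irrefl : ∀ {v} → ¬ (v ~ v)

infix 4 _≅_

-- This is isomorphism of plain graphs: for bipartite graphs, the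
-- bijection is not required to respect the given bipartitions.
record _≅_ (G H : Graph) : Set where
  private
    module G = Graph G
    module H = Graph H
  field
    bijection : G.Vertex ↔ H.Vertex
    adjacency : ∀ u v → (u G.~ v) ⇔
                (Inverse.to bijection u H.~ Inverse.to bijection v)

-- A not necessarily induced cycle: v₀ ~ v₁ ~ … ~ vₖ₋₁ ~ v₀ with the vᵢ
-- distinct and k ≥ 3.
record Cycle (G : Graph) (k : ℕ) : Set where
  open Graph G
  field
    3≤k       : 3 ≤ k
    vertex    : Fin k → Vertex
    injective : Injective _≡_ _≡_ vertex
    step      : ∀ i j → toℕ j ≡ suc (toℕ i) → vertex i ~ vertex j
    close     : ∀ i j → suc (toℕ i) ≡ k → toℕ j ≡ 0 → vertex i ~ vertex j

record BipartiteGraph (X Y : Set) : Set₁ where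
  field
    Adj  : X → Y → Set
    adj? : ∀ x y → Dec (Adj x y)

module _ {X Y : Set} (G : BipartiteGraph X Y) where
  open BipartiteGraph G

  private
    _~_ : X ⊎ Y → X ⊎ Y → Set
    inj₁ x ~ inj₁ x′ = ⊥
    inj₁ x ~ inj₂ y  = Adj x y
    inj₂ y ~ inj₁ x  = Adj x y
    inj₂ y ~ inj₂ y′ = ⊥

    sym : ∀ u v → u ~ v → v ~ u
    sym (inj₁ _) (inj₂ _) e = e
    sym (inj₂ _) (inj₁ _) e = e

    irrefl : ∀ v → ¬ (v ~ v)
    irrefl (inj₁ _) ()
    irrefl (inj₂ _) ()

  graph : Graph
  graph = record
    { Vertex   = X ⊎ Y
    ; _~_      = _~_
    ; ~-sym    = λ {u} {v} → sym u v
    ; ~-irrefl = λ {v} → irrefl v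
    }

neighbours : ∀ {X m} → BipartiteGraph X (Fin m) → X → Subset m
neighbours G x = tabulate (λ y → does (BipartiteGraph.adj? G x y))

degree : ∀ {X m} → BipartiteGraph X (Fin m) → X → ℕ
degree G x = ∣ neighbours G x ∣

data Y₁ (δ : ℕ) : Set where
  core              : Fin (δ ∸ 1) → Y₁ δ
  private-neighbour : Fin δ → Y₁ δ

G₁ : (δ : ℕ) → BipartiteGraph (Fin δ) (Y₁ δ)
G₁ δ = record { Adj = Adj ; adj? = adj? }
  where
  Adj : Fin δ → Y₁ δ → Set
  Adj x (core _)              = ⊤
  Adj x (private-neighbour i) = x ≡ i

  adj? : ∀ x y → Dec (Adj x y)
  adj? x (core _)              = yes tt
  adj? x (private-neighbour i) = x Fin.≟ i

-- The amalgamated part of size 2δ - 1: `shared` is the identified vertex,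
-- and `onlyᵢ` are the other δ - 1 vertices of the part of size δ of Hᵢ.
data Y₂ (δ : ℕ) : Set where
  shared : Y₂ δ
  only₁  : Fin (δ ∸ 1) → Y₂ δ
  only₂  : Fin (δ ∸ 1) → Y₂ δ

G₂ : (δ a b : ℕ) → BipartiteGraph (Fin a ⊎ Fin b) (Y₂ δ)
G₂ δ a b = record { Adj = Adj ; adj? = adj? }
  where
  Adj : Fin a ⊎ Fin b → Y₂ δ → Set
  Adj _        shared    = ⊤
  Adj (inj₁ _) (only₁ _) = ⊤
  Adj (inj₁ _) (only₂ _) = ⊥
  Adj (inj₂ _) (only₁ _) = ⊥
  Adj (inj₂ _) (only₂ _) = ⊤

  adj? : ∀ x y → Dec (Adj x y)
  adj? (inj₁ _) shared    = yes tt
  adj? (inj₂ _) shared    = yes tt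
  adj? (inj₁ _) (only₁ _) = yes tt
  adj? (inj₁ _) (only₂ _) = no λ ()
  adj? (inj₂ _) (only₁ _) = no λ ()
  adj? (inj₂ _) (only₂ _) = yes tt

{-# OPTIONS --safe #-}
-- The vertices of X are added one at a time.  While fewer than δ vertices are
-- present, either they lie on a cycle or they induce a G₂; in the latter case
-- the new vertex x either has neighbours on both sides off the shared vertex,
-- which gives a cycle through everything, or joins one side.  In the former
-- case let C be the cycle and D the set of vertices of C ∩ Y adjacent to x,
-- and suppose there is no cycle through x and C ∩ X.  Then the sets of
-- neighbours outside C of x and of the successors in C of the members of D are
-- pairwise disjoint, and since |Y| ≤ 2δ - 1 counting forces them to cover
-- Y ∖ C and forces these successors to be adjacent to all of C ∩ Y.  If
-- |D| = 1 (and |D| = 0 reduces to it), this gives G₂ with x alone on one side.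
-- If |D| ≥ 2, rerouting C where a member of D follows a non-member gives a
-- cycle through x, unless D = C ∩ Y, which gives G₁.

module Submission where

open import Data.Fin using (Fin)
open import Data.Nat using (ℕ; _+_; _*_; _∸_; _≤_; _≥_)
open import Data.Product using (_×_; ∃-syntax)
open import Data.Sum using (_⊎_)
open import Relation.Binary.PropositionalEquality using (_≡_)
open import Relation.Nullary using (¬_)
open import Defs

import Algebra.Solver.CommutativeMonoid
open import Data.Bool using (true; false)
open import Data.Empty using (⊥; ⊥-elim)
open import Data.Fin using (zero; suc; toℕ)
import Data.Fin as Fin
import Data.Fin.Properties as Finₚ
open import Data.Fin.Subset using (∣_∣)
open import Data.List
  using (List; []; _∷_; [_]; _++_; map; filter; length; lookup; allFin; tabulate)
import Data.List.Membership.DecPropositional as DecMembership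
open import Data.List.Membership.Propositional using (_∈_; _∉_; find)
open import Data.List.Membership.Propositional.Properties
  using (∈-∃++; ∈-++⁺ˡ; ∈-++⁺ʳ; ∈-++⁻; ∈-map⁺; ∈-map⁻; ∈-filter⁺; ∈-filter⁻; ∈-allFin; ∈-lookup)
open import Data.List.Properties
  using (map-++; map-id; map-∘; ++-assoc; length-++; length-map; length-tabulate;
         length-filter; filter-none; filter-notAll)
open import Data.List.Relation.Binary.Disjoint.Propositional using (Disjoint)
open import Data.List.Relation.Binary.Permutation.Propositional
  using (_↭_; ↭-refl; ↭-sym; ↭-trans; ↭-reflexive; prep; ↭⇒↭ₛ)
import Data.List.Relation.Binary.Permutation.Propositional.Properties as ↭
import Data.List.Relation.Binary.Permutation.Setoid.Properties as ↭ₛ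
open import Data.List.Relation.Unary.All using ([]; _∷_)
import Data.List.Relation.Unary.All as All
import Data.List.Relation.Unary.All.Properties as Allₚ
open import Data.List.Relation.Unary.AllPairs using ([]; _∷_)
import Data.List.Relation.Unary.AllPairs as AllPairs
open import Data.List.Relation.Unary.Any using (Any; here; there)
import Data.List.Relation.Unary.Any as Any
import Data.List.Relation.Unary.Any.Properties as Anyₚ
open import Data.List.Relation.Unary.Unique.Propositional using (Unique)
import Data.List.Relation.Unary.Unique.Propositional.Properties as Uniq
import Data.List.Relation.Unary.Unique.DecPropositional as UniqueDec
open import Data.Nat using (zero; suc; pred; z≤n; s≤s; _<_)
open import Data.Nat.Properties
open import Data.Nat.Tactic.RingSolver using (solve-∀)
open import Data.Product using (_,_; proj₁; proj₂; ∃)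
open import Data.Sum using (inj₁; inj₂)
open import Data.Sum.Function.Propositional using (_⊎-↔_)
open import Data.Unit using (tt)
import Data.Vec as Vec
open import Function.Base using (_∘_; id)
open import Function.Bundles using (_↔_; _⇔_; mk⇔; mk⤖; Equivalence; Inverse)
open import Function.Definitions using (Injective)
open import Function.Properties.Bijection using (⤖⇒↔)
open import Function.Properties.Inverse using (↔-sym)
open import Relation.Binary using (DecidableEquality)
open import Relation.Binary.PropositionalEquality
  using (_≢_; refl; sym; trans; cong; cong₂; subst; subst₂; setoid)
open import Relation.Nullary using (Dec; yes; no; does; ¬?; _×-dec_)
open import Relation.Nullary.Decidable using (map′)

-- Repetition-free lists and counting.

module _ {A : Set} where

  Unique-resp-↭ : {xs ys : List A} → xs ↭ ys → Unique xs → Unique ys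
  Unique-resp-↭ p = ↭ₛ.Unique-resp-↭ (setoid A) (↭⇒↭ₛ p)

  ++-uniqueˡ : (xs : List A) {ys : List A} → Unique (xs ++ ys) → Unique xs
  ++-uniqueˡ []       _        = []
  ++-uniqueˡ (x ∷ xs) (p ∷ ps) = Allₚ.++⁻ˡ xs p ∷ ++-uniqueˡ xs ps

  ++-disjoint : (xs : List A) {ys : List A} → Unique (xs ++ ys) → Disjoint xs ys
  ++-disjoint (x ∷ xs) (p ∷ ps) (here refl , v∈ys) = All.lookup (Allₚ.++⁻ʳ xs p) v∈ys refl
  ++-disjoint (x ∷ xs) (p ∷ ps) (there v∈xs , v∈ys) = ++-disjoint xs ps (v∈xs , v∈ys)

  ∷-unique : ∀ {x : A} {xs} → x ∉ xs → Unique xs → Unique (x ∷ xs)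
  ∷-unique x∉xs u = All.tabulate (λ { v∈ refl → x∉xs v∈ }) ∷ u

  ++-uniqueʳ : (xs : List A) {ys : List A} → Unique (xs ++ ys) → Unique ys
  ++-uniqueʳ []       u        = u
  ++-uniqueʳ (x ∷ xs) (_ ∷ ps) = ++-uniqueʳ xs ps

  lookup-injective : {xs : List A} → Unique xs → ∀ {i j} → lookup xs i ≡ lookup xs j → i ≡ j
  lookup-injective (p ∷ ps) {zero}  {zero}  eq = refl
  lookup-injective (p ∷ ps) {zero}  {suc j} eq = ⊥-elim (All.lookup p (∈-lookup j) eq)
  lookup-injective (p ∷ ps) {suc i} {zero}  eq = ⊥-elim (All.lookup p (∈-lookup i) (sym eq))
  lookup-injective (p ∷ ps) {suc i} {suc j} eq = cong suc (lookup-injective ps eq)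

  lookup-surjective : ∀ {xs : List A} {v} → v ∈ xs → ∃[ i ] lookup xs i ≡ v
  lookup-surjective (here refl) = zero , refl
  lookup-surjective (there p) with i , eq ← lookup-surjective p = suc i , eq

  ⊆⇒length-≤ : {xs ys : List A} → Unique xs → (∀ {v} → v ∈ xs → v ∈ ys) → length xs ≤ length ys
  ⊆⇒length-≤ [] _ = z≤n
  ⊆⇒length-≤ {x ∷ xs} (p ∷ ps) sub with as , bs , refl ← ∈-∃++ (sub (here refl)) =
    subst (suc (length xs) ≤_) (sym (↭.↭-length (↭.shift x as bs)))
      (s≤s (⊆⇒length-≤ ps λ v∈xs → drop (All.lookup p v∈xs)
        (↭.∈-resp-↭ (↭.shift x as bs) (sub (there v∈xs)))))
    where
    drop : ∀ {v} {zs : List A} → x ≢ v → v ∈ x ∷ zs → v ∈ zs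
    drop x≢v (here refl) = ⊥-elim (x≢v refl)
    drop x≢v (there q)   = q

  ∈⇒↭∷ : ∀ {z : A} {zs} → z ∈ zs → ∃[ zs′ ] zs ↭ z ∷ zs′
  ∈⇒↭∷ {z} z∈ with as , bs , refl ← ∈-∃++ z∈ = as ++ bs , ↭.shift z as bs

  nonempty : {xs : List A} → 0 < length xs → ∃[ x ] x ∈ xs
  nonempty {x ∷ _} _ = x , here refl

  module _ {P : A → Set} (P? : ∀ a → Dec (P a)) where

    -- Turns equality in a degree count into adjacency to a whole list: one rejected element would
    -- make the filtered list strictly shorter.
    full-filter : ∀ {xs} → length xs ≤ length (filter P? xs) → ∀ {v} → v ∈ xs → P v
    full-filter {xs} le {v} v∈ with P? v
    ... | yes p = p
    ... | no ¬p = ⊥-elim (<⇒≱ (filter-notAll P? xs (Any.map (λ { refl → ¬p }) v∈)) le)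

    boundary : ∀ z (zs : List A) → ¬ P z → Any P zs →
               ∃[ as ] ∃[ a ] ∃[ b ] ∃[ bs ] z ∷ zs ≡ as ++ a ∷ b ∷ bs × ¬ P a × P b
    boundary z (z′ ∷ zs) ¬p any with P? z′
    ... | yes p = [] , z , z′ , zs , refl , ¬p , p
    boundary z (z′ ∷ zs) ¬p (here p)  | no ¬p′ = ⊥-elim (¬p′ p)
    boundary z (z′ ∷ zs) ¬p (there q) | no ¬p′
      with as , a , b , bs , eq , r ← boundary z′ zs ¬p′ q = z ∷ as , a , b , bs , cong (z ∷_) eq , r

  module _ {B : Set} (f : A → B) where

    map-unique-injective : ∀ {xs a b} → Unique (map f xs) → a ∈ xs → b ∈ xs → f a ≡ f b → a ≡ b
    map-unique-injective (p ∷ ps) (here refl) (here refl) _ = refl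
    map-unique-injective (p ∷ ps) (here refl) (there b∈) eq = ⊥-elim (All.lookup p (∈-map⁺ f b∈) eq)
    map-unique-injective (p ∷ ps) (there a∈) (here refl) eq = ⊥-elim (All.lookup p (∈-map⁺ f a∈) (sym eq))
    map-unique-injective (p ∷ ps) (there a∈) (there b∈) eq = map-unique-injective ps a∈ b∈ eq

    -- `f` acts as a key, and `g` has to separate only entries with different keys. In
    -- `leaves-unique` the key is the Y-vertex of a step, because outer neighbourhoods are known to
    -- be disjoint only for steps with different Y-vertices.
    map-unique : ∀ {C : Set} (g : A → C) {xs} → Unique (map f xs) →
                 (∀ {a b} → a ∈ xs → b ∈ xs → f a ≢ f b → g a ≢ g b) → Unique (map g xs)
    map-unique g {[]} [] h = []
    map-unique g {x ∷ xs} (p ∷ ps) h =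
      Allₚ.map⁺ (All.tabulate λ b∈ → h (here refl) (there b∈) (All.lookup p (∈-map⁺ f b∈)))
      ∷ map-unique g ps λ a∈ b∈ → h (there a∈) (there b∈)

  module _ (_≟ᴬ_ : DecidableEquality A) where

    open DecMembership _≟ᴬ_ using (_∈?_)

    infix 4 _↭?_

    _↭?_ : (xs ys : List A) → Dec (xs ↭ ys)
    [] ↭? []      = yes ↭-refl
    [] ↭? (y ∷ ys) = no λ p → ↭.¬x∷xs↭[] (↭-sym p)
    (x ∷ xs) ↭? ys with x ∈? ys
    ... | no x∉ys = no λ p → x∉ys (↭.∈-resp-↭ p (here refl))
    ... | yes x∈ys with as , bs , refl ← ∈-∃++ x∈ys =
      map′ (λ p → ↭-trans (prep x p) (↭-sym (↭.shift x as bs)))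
           (λ p → ↭.drop-∷ (↭-trans p (↭.shift x as bs)))
           (xs ↭? (as ++ bs))

  search : {P : List A → Set} → (∀ l → Dec (P l)) →
           (∀ {Q : A → Set} → (∀ a → Dec (Q a)) → Dec (∃ Q)) →
           ∀ k → Dec (∃[ l ] length l ≡ k × P l)
  search P? any zero = map′ (λ p → [] , refl , p) (λ { ([] , _ , p) → p }) (P? [])
  search P? any (suc k) =
    map′ (λ { (a , l , refl , p) → a ∷ l , refl , p })
         (λ { (a ∷ l , refl , p) → a , l , refl , p })
         (any λ a → search (P? ∘ (a ∷_)) any k)

  module ↭-Solver = Algebra.Solver.CommutativeMonoid (↭.++-commutativeMonoid {A = A})

module _ {m : ℕ} where

  open DecMembership (Fin._≟_ {m}) using (_∈?_)

  unique-length-≤ : {l : List (Fin m)} → Unique l → length l ≤ m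
  unique-length-≤ {l} u =
    subst (length l ≤_) (length-tabulate id) (⊆⇒length-≤ u λ {v} _ → ∈-allFin v)

  -- Pigeonhole: a missing element could be prepended, giving a repetition-free list longer than
  -- `m`.
  unique-complete : {l : List (Fin m)} → Unique l → m ≤ length l → ∀ y → y ∈ l
  unique-complete {l} u le y with y ∈? l
  ... | yes y∈ = y∈
  ... | no  y∉ = ⊥-elim (<⇒≱ (s≤s le) (unique-length-≤ (∷-unique y∉ u)))

-- Isomorphisms of graphs.

cast-injective : ∀ {k l} .{eq : k ≡ l} {i j : Fin k} → Fin.cast eq i ≡ Fin.cast eq j → i ≡ j
cast-injective {eq = eq} {i} {j} e =
  Finₚ.toℕ-injective (trans (sym (Finₚ.toℕ-cast eq i)) (trans (cong toℕ e) (Finₚ.toℕ-cast eq j)))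

-- Allows the final isomorphisms to be built out of `G₁` and `G₂`, where maps are defined by cases
-- on the constructors.
≅-sym : ∀ {G H} → G ≅ H → H ≅ G
≅-sym {G} {H} iso = record
  { bijection = ↔-sym bijection
  ; adjacency = λ u v → mk⇔
      (λ e → Equivalence.from (adjacency (from u) (from v))
               (subst₂ (Graph._~_ H) (sym (inverseˡ refl)) (sym (inverseˡ refl)) e))
      (λ e → subst₂ (Graph._~_ H) (inverseˡ refl) (inverseˡ refl)
               (Equivalence.to (adjacency (from u) (from v)) e))
  }
  where
  open _≅_ iso
  open Inverse bijection using (from; inverseˡ)

module _ {X Y X′ Y′ : Set} {G : BipartiteGraph X Y} {H : BipartiteGraph X′ Y′} where
  private
    module G = BipartiteGraph G
    module H = BipartiteGraph H

  bipartite-iso : (f : X → X′) (g : Y → Y′) →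
                  Injective _≡_ _≡_ f → (∀ x → ∃[ u ] f u ≡ x) →
                  Injective _≡_ _≡_ g → (∀ y → ∃[ u ] g u ≡ y) →
                  (∀ x y → G.Adj x y ⇔ H.Adj (f x) (g y)) → graph G ≅ graph H
  bipartite-iso f g f-inj f-surj g-inj g-surj adj = record
    { bijection = bij f f-inj f-surj ⊎-↔ bij g g-inj g-surj
    ; adjacency = λ where
        (inj₁ _) (inj₁ _) → mk⇔ id id
        (inj₁ x) (inj₂ y) → adj x y
        (inj₂ y) (inj₁ x) → adj x y
        (inj₂ _) (inj₂ _) → mk⇔ id id
    }
    where
    bij : ∀ {A B : Set} (h : A → B) → Injective _≡_ _≡_ h → (∀ b → ∃[ a ] h a ≡ b) → A ↔ B
    bij h inj surj = ⤖⇒↔ (mk⤖ (inj , λ b → proj₁ (surj b) , λ { refl → proj₂ (surj b) }))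

-- Walks and cycles in a bipartite graph.

module Walks {n m : ℕ} (G : BipartiteGraph (Fin n) (Fin m)) where
  open BipartiteGraph G

  X Y : Set
  X = Fin n
  Y = Fin m

  Steps : Set
  Steps = List (Y × X)

  ys : Steps → List Y
  ys = map proj₁

  xs : Steps → List X
  xs = map proj₂

  -- A step (y , w) goes from the current vertex through y to w; so a closed
  -- walk can be rotated by swapping the two halves of its list of steps.
  data Walk : X → Steps → X → Set where
    []  : ∀ {u} → Walk u [] u
    cons : ∀ {u y w L v} → Adj u y → Adj w y → Walk w L v → Walk u ((y , w) ∷ L) v

  infixr 5 _⧺_

  _⧺_ : ∀ {u v w L M} → Walk u L v → Walk v M w → Walk u (L ++ M) w
  []         ⧺ q = q
  cons e f p ⧺ q = cons e f (p ⧺ q)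

  split : ∀ {u w} L {M} → Walk u (L ++ M) w → ∃[ v ] Walk u L v × Walk v M w
  split []      p            = _ , [] , p
  split (_ ∷ L) (cons e f p) with v , q , r ← split L p = v , cons e f q , r

  -- A list of steps omits the starting vertex of its walk, so both starting vertices are put back
  -- before the X-vertices are compared.
  reverse : ∀ {u L v} → Walk u L v →
            ∃[ M ] Walk v M u × ys M ↭ ys L × v ∷ xs M ↭ u ∷ xs L
  reverse [] = [] , [] , ↭-refl , ↭-refl
  reverse {u} {(y , w) ∷ L} {v} (cons e f p) with M , q , py , px ← reverse p =
    M ++ (y , u) ∷ [] , q ⧺ cons f e []
    , ↭-trans (↭-reflexive (map-++ proj₁ M _)) (↭-trans (↭.++-comm (ys M) [ y ]) (prep y py))
    , ↭-trans (prep v (↭-reflexive (map-++ proj₂ M _)))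
        (↭-trans (↭.++-comm (v ∷ xs M) [ u ]) (prep u px))

  -- If vs is a single vertex, any of its edges, traversed back and forth, is
  -- a cycle in this sense; this starts the induction.
  record CycleOn (vs : List X) : Set where
    constructor cycleOn
    field
      {base}   : X
      {steps}  : Steps
      walk     : Walk base steps base
      unique   : Unique (ys steps)
      covers   : xs steps ↭ vs

  walk? : ∀ u L v → Dec (Walk u L v)
  walk? u [] v = map′ (λ { refl → [] }) (λ { [] → refl }) (u Fin.≟ v)
  walk? u ((y , w) ∷ L) v =
    map′ (λ (e , f , p) → cons e f p) (λ { (cons e f p) → e , f , p })
         (adj? u y ×-dec adj? w y ×-dec walk? w L v)

  -- A cycle on `vs` has exactly `length vs` steps, so a finite search decides its existence; the
  -- case distinction in `grow` is constructive for this reason.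
  cycleOn? : ∀ vs → Dec (CycleOn vs)
  cycleOn? vs =
    map′ (λ (_ , _ , _ , p , u , c) → cycleOn p u c)
         (λ { (cycleOn {w} {L} p u c) → L , trans (sym (length-map proj₂ L)) (↭.↭-length c) , w , p , u , c })
         (search (λ L → Finₚ.any? λ w →
             walk? w L w ×-dec UniqueDec.unique? Fin._≟_ (ys L) ×-dec _↭?_ Fin._≟_ (xs L) vs)
           (λ Q? → map′ (λ (y , x , q) → (y , x) , q) (λ ((y , x) , q) → y , x , q)
              (Finₚ.any? λ y → Finₚ.any? λ x → Q? (y , x)))
           (length vs))

  -- The extremal configurations.

  G₂-side : (A : List X) (s : Y) (P Q : List Y) → Set
  G₂-side A s P Q = (∃[ a ] a ∈ A)
                  × (∀ {a y} → a ∈ A → y ∈ s ∷ P → Adj a y)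
                  × (∀ {a y} → a ∈ A → y ∈ Q → ¬ Adj a y)

  -- Only adjacencies of `vs` are described, but `hub ∷ P ++ Q` must enumerate all of Y, so that Y
  -- has exactly 2δ - 1 elements as soon as this structure appears.
  record G₂-on (δ : ℕ) (vs : List X) : Set where
    field
      A B      : List X
      hub      : Y
      P Q      : List Y
      vertices : A ++ B ↭ vs
      unique   : Unique (hub ∷ P ++ Q)
      complete : ∀ y → y ∈ hub ∷ P ++ Q
      |P|      : suc (length P) ≡ δ
      |Q|      : suc (length Q) ≡ δ
      sideA    : G₂-side A hub P Q
      sideB    : G₂-side B hub Q P

  -- `kernel` plays the role of Y₀ and `leaf` chooses the private neighbours. By `|vs|` this can
  -- occur only when δ vertices are present, which is at the end of the induction.
  record G₁-on (δ : ℕ) (vs : List X) : Set where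
    field
      kernel   : List Y
      leaf     : X → Y
      unique   : Unique (kernel ++ map leaf vs)
      complete : ∀ y → y ∈ kernel ++ map leaf vs
      |kernel| : suc (length kernel) ≡ δ
      |vs|     : length vs ≡ δ
      adjᵏ     : ∀ {a y} → a ∈ vs → y ∈ kernel → Adj a y
      adjˡ     : ∀ {a} → a ∈ vs → Adj a (leaf a)
      adjˡ⁻    : ∀ {a b} → a ∈ vs → b ∈ vs → Adj a (leaf b) → leaf a ≡ leaf b

  N : X → List Y
  N a = filter (adj? a) (allFin m)

  degree≡|N| : ∀ a → degree G a ≡ length (N a)
  degree≡|N| a = go id
    where
    -- Generalised from `id`, since the induction replaces the tabulated function by `f ∘ suc`.
    go : ∀ {k} (f : Fin k → Y) →
         ∣ Vec.tabulate (does ∘ adj? a ∘ f) ∣ ≡ length (filter (adj? a) (tabulate f))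
    go {zero}  f = refl
    go {suc k} f with does (adj? a (f zero))
    ... | true  = cong suc (go (f ∘ suc))
    ... | false = go (f ∘ suc)

  G₂-swap : ∀ {δ vs} → G₂-on δ vs → G₂-on δ vs
  G₂-swap H = record
    { A = B ; B = A ; hub = hub ; P = Q ; Q = P
    ; vertices = ↭-trans (↭.++-comm B A) vertices
    ; unique   = Unique-resp-↭ (prep hub (↭.++-comm P Q)) unique
    ; complete = λ y → ↭.∈-resp-↭ (prep hub (↭.++-comm P Q)) (complete y)
    ; |P| = |Q| ; |Q| = |P| ; sideA = sideB ; sideB = sideA
    }
    where open G₂-on H

  -- Counting neighbours on and off a cycle.

  module Bounds (δ : ℕ) (m<2δ : m < δ + δ) (deg : ∀ a → δ ≤ length (N a)) where

    open DecMembership (Fin._≟_ {m}) using (_∈?_)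

    -- `Ys` will be the set of Y-vertices of a cycle; `inner` and `outer` split each neighbourhood
    -- into its parts on and off the cycle.
    module Outside (Ys : List Y) (Ys! : Unique Ys) where

      k = length Ys

      outside? : ∀ a y → Dec (Adj a y × y ∉ Ys)
      outside? a y = adj? a y ×-dec ¬? (y ∈? Ys)

      inner outer : X → List Y
      inner a = filter (adj? a) Ys
      outer a = filter (outside? a) (allFin m)

      ∈-outer : ∀ {a y} → Adj a y → y ∉ Ys → y ∈ outer a
      ∈-outer {a} {y} e y∉ = ∈-filter⁺ (outside? a) (∈-allFin y) (e , y∉)

      ∈-outer⁻ : ∀ {a y} → y ∈ outer a → Adj a y × y ∉ Ys
      ∈-outer⁻ {a} y∈ = proj₂ (∈-filter⁻ (outside? a) {xs = allFin m} y∈)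

      outer-unique : ∀ a → Unique (outer a)
      outer-unique a = Uniq.filter⁺ (outside? a) (Uniq.allFin⁺ m)

      inner-≤ : ∀ a → length (inner a) ≤ k
      inner-≤ a = length-filter (adj? a) Ys

      inner+outer : ∀ a → δ ≤ length (inner a) + length (outer a)
      inner+outer a = ≤-trans (deg a) (subst (length (N a) ≤_) (length-++ (inner a))
          (⊆⇒length-≤ (Uniq.filter⁺ (adj? a) (Uniq.allFin⁺ m)) λ {v} v∈ →
            place v (proj₂ (∈-filter⁻ (adj? a) {xs = allFin m} v∈))))
        where
        place : ∀ v → Adj a v → v ∈ inner a ++ outer a
        place v e with v ∈? Ys
        ... | yes v∈ = ∈-++⁺ˡ (∈-filter⁺ (adj? a) v∈ e)
        ... | no  v∉ = ∈-++⁺ʳ (inner a) (∈-outer e v∉)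

      -- `R` stands for further vertices known to avoid the other three sets. It is empty when x has
      -- at most one neighbour on the cycle, and otherwise consists of chosen outer neighbours of
      -- other vertices.
      record Separated (a b : X) (R : List Y) : Set where
        field
          ab : Disjoint (outer a) (outer b)
          R! : Unique R
          R⊥ : ∀ {r} → r ∈ R → r ∉ Ys × r ∉ outer a × r ∉ outer b

      blocks : X → X → List Y → List Y
      blocks a b R = Ys ++ outer a ++ outer b ++ R

      blocks-unique : ∀ {a b R} → Separated a b R → Unique (blocks a b R)
      blocks-unique {a} {b} {R} s =
        Uniq.++⁺ Ys! (Uniq.++⁺ (outer-unique a)
          (Uniq.++⁺ (outer-unique b) R! (λ (p , q) → proj₂ (proj₂ (R⊥ q)) p)) d₂) d₁
        where
        open Separated s
        d₂ : Disjoint (outer a) (outer b ++ R)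
        d₂ (p , q) with ∈-++⁻ (outer b) q
        ... | inj₁ q′ = ab (p , q′)
        ... | inj₂ q′ = proj₁ (proj₂ (R⊥ q′)) p
        d₁ : Disjoint Ys (outer a ++ outer b ++ R)
        d₁ (p , q) with ∈-++⁻ (outer a) q
        ... | inj₁ q′ = proj₂ (∈-outer⁻ q′) p
        ... | inj₂ q′ with ∈-++⁻ (outer b) q′
        ...   | inj₁ q″ = proj₂ (∈-outer⁻ q″) p
        ...   | inj₂ q″ = proj₁ (R⊥ q″) p

      blocks-length : ∀ a b R → length (blocks a b R) ≡ k + (length (outer a) + (length (outer b) + length R))
      blocks-length a b R =
        trans (length-++ Ys) (cong (k +_)
          (trans (length-++ (outer a)) (cong (length (outer a) +_) (length-++ (outer b)))))

      blocks-< : ∀ {a b R} → Separated a b R →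
                 k + (length (outer a) + (length (outer b) + length R)) < δ + δ
      blocks-< {a} {b} {R} s =
        ≤-<-trans (subst (_≤ m) (blocks-length a b R) (unique-length-≤ (blocks-unique s))) m<2δ

      -- The disjoint blocks have total size below 2δ, while the degrees of `a` and `b` add up to at
      -- least 2δ; both sides contain the two outer parts, which cancel.
      inner-large : ∀ {a b R} → Separated a b R → k + length R < length (inner a) + length (inner b)
      inner-large {a} {b} {R} s =
        arith k (length (outer a)) (length (outer b)) (length R) (length (inner a)) (length (inner b))
          (blocks-< s) (inner+outer a) (inner+outer b)
        where
        arith : ∀ k oa ob r ia ib → k + (oa + (ob + r)) < δ + δ → δ ≤ ia + oa → δ ≤ ib + ob → k + r < ia + ib
        arith k oa ob r ia ib h p q = +-cancelʳ-< (oa + ob) (k + r) (ia + ib)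
          (begin-strict
            (k + r) + (oa + ob)   ≡⟨ e₁ k r oa ob ⟩
            k + (oa + (ob + r))   <⟨ h ⟩
            δ + δ                 ≤⟨ +-mono-≤ p q ⟩
            (ia + oa) + (ib + ob) ≡⟨ e₂ ia oa ib ob ⟩
            (ia + ib) + (oa + ob) ∎)
          where
          open ≤-Reasoning
          e₁ : ∀ k r oa ob → (k + r) + (oa + ob) ≡ k + (oa + (ob + r))
          e₁ = solve-∀
          e₂ : ∀ ia oa ib ob → (ia + oa) + (ib + ob) ≡ (ia + ib) + (oa + ob)
          e₂ = solve-∀

      -- When R has at least as many elements as a has inner neighbours, less one,
      -- every estimate behind inner-large is an equality.
      module Tight {a b R} (s : Separated a b R) (ia≤ : length (inner a) ≤ suc (length R)) where

        private
          oa = length (outer a)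
          ob = length (outer b)
          r  = length R

        -- `inner-large` and `ia≤` leave `b` at least `k` neighbours among the `k` elements of `Ys`.
        b-full : ∀ {y} → y ∈ Ys → Adj b y
        b-full = full-filter (adj? b) (+-cancelʳ-≤ (suc r) k (length (inner b))
          (begin
            k + suc r                           ≡⟨ +-suc k r ⟩
            suc (k + r)                         ≤⟨ inner-large s ⟩
            length (inner a) + length (inner b) ≤⟨ +-monoˡ-≤ (length (inner b)) ia≤ ⟩
            suc r + length (inner b)            ≡⟨ +-comm (suc r) _ ⟩
            length (inner b) + suc r            ∎))
          where open ≤-Reasoning

        δ≤a : δ ≤ suc r + oa
        δ≤a = ≤-trans (inner+outer a) (+-monoˡ-≤ oa ia≤)

        δ≤b : δ ≤ k + ob
        δ≤b = ≤-trans (inner+outer b) (+-monoˡ-≤ ob (inner-≤ b))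

        sum : (suc r + oa) + (k + ob) ≤ δ + δ
        sum = subst (_≤ δ + δ) (e k oa ob r) (blocks-< s)
          where
          e : ∀ k oa ob r → suc (k + (oa + (ob + r))) ≡ (suc r + oa) + (k + ob)
          e = solve-∀

        -- Two numbers that are each at least δ and whose sum is at most 2δ are both δ.
        |a| : suc r + oa ≡ δ
        |a| = ≤-antisym (+-cancelʳ-≤ δ _ _ (≤-trans (+-monoʳ-≤ (suc r + oa) δ≤b) sum)) δ≤a

        |b| : k + ob ≡ δ
        |b| = ≤-antisym (+-cancelˡ-≤ δ _ _ (≤-trans (+-monoˡ-≤ (k + ob) δ≤a) sum)) δ≤b

        -- By `δ≤a` and `δ≤b` the blocks have at least 2δ - 1 ≥ m elements, so they exhaust Y.
        complete : ∀ y → y ∈ blocks a b R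
        complete = unique-complete (blocks-unique s) (subst (m ≤_) (sym (blocks-length a b R))
          (+-cancelˡ-≤ 1 _ _ (begin
            suc m                             ≤⟨ m<2δ ⟩
            δ + δ                             ≤⟨ +-mono-≤ δ≤a δ≤b ⟩
            (suc r + oa) + (k + ob)           ≡⟨ e k oa ob r ⟨
            suc (k + (oa + (ob + r)))         ∎)))
          where
          open ≤-Reasoning
          e : ∀ k oa ob r → suc (k + (oa + (ob + r))) ≡ (suc r + oa) + (k + ob)
          e = solve-∀

    -- Rerouting a cycle through a new vertex x.

    module Reroute {x vs} (acyclic : ¬ CycleOn (x ∷ vs)) {Z₀ : Steps}
                   (Ys! : Unique (ys Z₀)) (covers : xs Z₀ ↭ vs) where

      open Outside (ys Z₀) Ys!
      open ↭-Solver using (solve; _⊕_; _⊜_)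

      -- Rotations of the cycle are compared with the fixed `Z₀` up to permutation, so `inner` and
      -- `outer` mean the same for all of them.
      record Closed (w : X) (Z : Steps) : Set where
        constructor closed
        field
          walk : Walk w Z w
          perm : Z ↭ Z₀

      rotate : ∀ {w} Z₁ {Z₂} → Closed w (Z₁ ++ Z₂) → ∃[ v ] Closed v (Z₂ ++ Z₁)
      rotate Z₁ {Z₂} (closed p σ) with v , p₁ , p₂ ← split Z₁ p =
        v , closed (p₂ ⧺ p₁) (↭-trans (↭.++-comm Z₂ Z₁) σ)

      private
        ∉-perm : ∀ {r Z} → Z ↭ Z₀ → r ∉ ys Z₀ → r ∉ ys Z
        ∉-perm σ r∉ r∈ = r∉ (↭.∈-resp-↭ (↭.map⁺ proj₁ σ) r∈)

        ys! : ∀ {Z} → Z ↭ Z₀ → Unique (ys Z)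
        ys! σ = Unique-resp-↭ (↭-sym (↭.map⁺ proj₁ σ)) Ys!

      -- Most reroutings keep every Y-vertex of the cycle and add one vertex r off it; for these
      -- only a walk and two permutations remain to be given.
      extend : ∀ {Z Z′ r} → Z ↭ Z₀ → Walk x Z′ x → r ∉ ys Z₀ →
               ys Z′ ↭ r ∷ ys Z → xs Z′ ↭ x ∷ xs Z → ⊥
      extend σ p r∉ py px = acyclic (cycleOn p
        (Unique-resp-↭ (↭-sym py) (∷-unique (∉-perm σ r∉) (ys! σ)))
        (↭-trans px (prep x (↭-trans (↭.map⁺ proj₂ σ) covers))))

      -- If r and r′ differed, the passage w y a of the cycle could be replaced by w r x r′ a,
      -- dropping y.
      insert : ∀ {w y a L r r′} → Closed w ((y , a) ∷ L) → r ∉ ys Z₀ → r′ ∉ ys Z₀ →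
               Adj w r → Adj x r → Adj x r′ → Adj a r′ → r ≡ r′
      insert {w} {y} {a} {L} {r} {r′} (closed (cons _ _ p) σ) r∉ r′∉ wr xr xr′ ar′ with r Fin.≟ r′
      ... | yes eq = eq
      ... | no r≢r′ with _ ∷ L! ← ys! σ = ⊥-elim (acyclic (cycleOn
        (cons xr′ ar′ (p ⧺ cons wr xr []))
        (Unique-resp-↭ (↭-sym py) (∷-unique (λ { (here eq) → r≢r′ eq ; (there r∈) → ∉-perm σ r∉ (there r∈) })
          (∷-unique (∉-perm σ r′∉ ∘ there) L!)))
        (↭-trans px (prep x (↭-trans (↭.map⁺ proj₂ σ) covers)))))
        where
        py : ys ((r′ , a) ∷ L ++ (r , x) ∷ []) ↭ r ∷ r′ ∷ ys L
        py rewrite map-++ proj₁ L ((r , x) ∷ []) =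
          solve 3 (λ r r′ l → r′ ⊕ (l ⊕ r) ⊜ r ⊕ (r′ ⊕ l)) ↭-refl [ r ] [ r′ ] (ys L)
        px : xs ((r′ , a) ∷ L ++ (r , x) ∷ []) ↭ x ∷ a ∷ xs L
        px rewrite map-++ proj₂ L ((r , x) ∷ []) =
          solve 3 (λ x a l → a ⊕ (l ⊕ x) ⊜ x ⊕ (a ⊕ l)) ↭-refl [ x ] [ a ] (xs L)

      -- The new cycle would be x y a ⋯ w r x.
      insert-last : ∀ {w y a L r} → Closed w ((y , a) ∷ L) → Adj x y → r ∉ ys Z₀ →
                    Adj x r → ¬ Adj w r
      insert-last {w} {y} {a} {L} {r} (closed (cons _ ay p) σ) xy r∉ xr wr =
        extend σ (cons xy ay (p ⧺ cons wr xr [])) r∉ py px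
        where
        py : ys ((y , a) ∷ L ++ (r , x) ∷ []) ↭ r ∷ y ∷ ys L
        py rewrite map-++ proj₁ L ((r , x) ∷ []) =
          solve 3 (λ r y l → y ⊕ (l ⊕ r) ⊜ r ⊕ (y ⊕ l)) ↭-refl [ r ] [ y ] (ys L)
        px : xs ((y , a) ∷ L ++ (r , x) ∷ []) ↭ x ∷ a ∷ xs L
        px rewrite map-++ proj₂ L ((r , x) ∷ []) =
          solve 3 (λ x a l → a ⊕ (l ⊕ x) ⊜ x ⊕ (a ⊕ l)) ↭-refl [ x ] [ a ] (xs L)

      -- The new cycle would be x r a ⋯ w y x.
      insert-first : ∀ {w y a L r} → Closed w ((y , a) ∷ L) → Adj x y → r ∉ ys Z₀ →
                     Adj x r → ¬ Adj a r
      insert-first {w} {y} {a} {L} {r} (closed (cons wy _ p) σ) xy r∉ xr ar =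
        extend σ (cons xr ar (p ⧺ cons wy xy [])) r∉ py px
        where
        py : ys ((r , a) ∷ L ++ (y , x) ∷ []) ↭ r ∷ y ∷ ys L
        py rewrite map-++ proj₁ L ((y , x) ∷ []) =
          solve 3 (λ r y l → r ⊕ (l ⊕ y) ⊜ r ⊕ (y ⊕ l)) ↭-refl [ r ] [ y ] (ys L)
        px : xs ((r , a) ∷ L ++ (y , x) ∷ []) ↭ x ∷ a ∷ xs L
        px rewrite map-++ proj₂ L ((y , x) ∷ []) =
          solve 3 (λ x a l → a ⊕ (l ⊕ x) ⊜ x ⊕ (a ⊕ l)) ↭-refl [ x ] [ a ] (xs L)

      -- The new cycle is x y′ v ⋯ b r a ⋯ w y x, with the arc b ⋯ v reversed.
      cross : ∀ {w y b y′ a r} L₁ {L₂} → Closed w ((y , b) ∷ L₁ ++ (y′ , a) ∷ L₂) →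
              Adj x y → Adj x y′ → r ∉ ys Z₀ → Adj b r → ¬ Adj a r
      cross {w} {y} {b} {y′} {a} {r} L₁ {L₂} (closed (cons wy _ p) σ) xy xy′ r∉ br ar
        with v , p₁ , cons vy′ _ p₂ ← split L₁ p
        with M , q , qy , qx ← reverse p₁ =
        extend σ (cons xy′ vy′ (q ⧺ cons br ar (p₂ ⧺ cons wy xy []))) r∉ py px
        where
        py : ys ((y′ , v) ∷ M ++ (r , a) ∷ L₂ ++ (y , x) ∷ []) ↭ r ∷ ys ((y , b) ∷ L₁ ++ (y′ , a) ∷ L₂)
        py rewrite map-++ proj₁ M ((r , a) ∷ L₂ ++ (y , x) ∷ []) | map-++ proj₁ L₂ ((y , x) ∷ [])
                 | map-++ proj₁ L₁ ((y′ , a) ∷ L₂) =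
          ↭-trans (prep y′ (↭.++⁺ʳ _ qy))
            (solve 5 (λ y′ l₁ r l₂ y → y′ ⊕ (l₁ ⊕ (r ⊕ (l₂ ⊕ y))) ⊜ r ⊕ (y ⊕ (l₁ ⊕ (y′ ⊕ l₂)))) ↭-refl
              [ y′ ] (ys L₁) [ r ] (ys L₂) [ y ])
        px : xs ((y′ , v) ∷ M ++ (r , a) ∷ L₂ ++ (y , x) ∷ []) ↭ x ∷ xs ((y , b) ∷ L₁ ++ (y′ , a) ∷ L₂)
        px rewrite map-++ proj₂ M ((r , a) ∷ L₂ ++ (y , x) ∷ []) | map-++ proj₂ L₂ ((y , x) ∷ [])
                 | map-++ proj₂ L₁ ((y′ , a) ∷ L₂) =
          ↭-trans (↭.++⁺ʳ _ qx)
            (solve 5 (λ b l₁ a l₂ x → (b ⊕ l₁) ⊕ (a ⊕ (l₂ ⊕ x)) ⊜ x ⊕ (b ⊕ (l₁ ⊕ (a ⊕ l₂)))) ↭-refl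
              [ b ] (xs L₁) [ a ] (xs L₂) [ x ])

      -- The new cycle is x y a ⋯ w r b ⋯ v y′ x
      shortcut : ∀ {w y b y′ a r} L₁ {L₂} → Closed w ((y , b) ∷ L₁ ++ (y′ , a) ∷ L₂) →
                 Adj x y → Adj x y′ → Adj a y → r ∉ ys Z₀ → Adj b r → ¬ Adj w r
      shortcut {w} {y} {b} {y′} {a} {r} L₁ {L₂} (closed (cons _ _ p) σ) xy xy′ ay r∉ br wr
        with v , p₁ , cons vy′ _ p₂ ← split L₁ p =
        extend σ (cons xy ay (p₂ ⧺ cons wr br (p₁ ⧺ cons vy′ xy′ []))) r∉ py px
        where
        py : ys ((y , a) ∷ L₂ ++ (r , b) ∷ L₁ ++ (y′ , x) ∷ []) ↭ r ∷ ys ((y , b) ∷ L₁ ++ (y′ , a) ∷ L₂)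
        py rewrite map-++ proj₁ L₂ ((r , b) ∷ L₁ ++ (y′ , x) ∷ [])
                 | map-++ proj₁ L₁ ((y′ , x) ∷ []) | map-++ proj₁ L₁ ((y′ , a) ∷ L₂) =
          solve 5 (λ y′ l₁ r l₂ y → y ⊕ (l₂ ⊕ (r ⊕ (l₁ ⊕ y′))) ⊜ r ⊕ (y ⊕ (l₁ ⊕ (y′ ⊕ l₂)))) ↭-refl
              [ y′ ] (ys L₁) [ r ] (ys L₂) [ y ]
        px : xs ((y , a) ∷ L₂ ++ (r , b) ∷ L₁ ++ (y′ , x) ∷ []) ↭ x ∷ xs ((y , b) ∷ L₁ ++ (y′ , a) ∷ L₂)
        px rewrite map-++ proj₂ L₂ ((r , b) ∷ L₁ ++ (y′ , x) ∷ [])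
                 | map-++ proj₂ L₁ ((y′ , x) ∷ []) | map-++ proj₂ L₁ ((y′ , a) ∷ L₂) =
          solve 5 (λ b l₁ a l₂ x → a ⊕ (l₂ ⊕ (b ⊕ (l₁ ⊕ x))) ⊜ x ⊕ (b ⊕ (l₁ ⊕ (a ⊕ l₂)))) ↭-refl
              [ b ] (xs L₁) [ a ] (xs L₂) [ x ]

      -- The new cycle is x y w r a ⋯ t y″ b ⋯ v y′ x, where t y″ is the last step before w.
      shortcut₂ : ∀ {w y b y′ a y″ c r} L₁ L₂ →
                  Closed w ((y , b) ∷ L₁ ++ (y′ , a) ∷ L₂ ++ (y″ , c) ∷ []) →
                  Adj x y → Adj x y′ → Adj b y″ → r ∉ ys Z₀ → Adj a r → ¬ Adj w r
      shortcut₂ {w} {y} {b} {y′} {a} {y″} {c} {r} L₁ L₂ (closed (cons wy _ p) σ) xy xy′ by″ r∉ ar wr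
        with v , p₁ , cons vy′ _ p₂ ← split L₁ p
        with t , p₃ , cons ty″ _ [] ← split L₂ p₂ =
        extend σ (cons xy wy (cons wr ar (p₃ ⧺ cons ty″ by″ (p₁ ⧺ cons vy′ xy′ [])))) r∉ py px
        where
        py : ys ((y , w) ∷ (r , a) ∷ L₂ ++ (y″ , b) ∷ L₁ ++ (y′ , x) ∷ [])
             ↭ r ∷ ys ((y , b) ∷ L₁ ++ (y′ , a) ∷ L₂ ++ (y″ , w) ∷ [])
        py rewrite map-++ proj₁ L₂ ((y″ , b) ∷ L₁ ++ (y′ , x) ∷ [])
                 | map-++ proj₁ L₁ ((y′ , x) ∷ [])
                 | map-++ proj₁ L₁ ((y′ , a) ∷ L₂ ++ (y″ , w) ∷ [])
                 | map-++ proj₁ L₂ ((y″ , w) ∷ []) =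
          solve 6 (λ y′ l₁ r l₂ y y″ → y ⊕ (r ⊕ (l₂ ⊕ (y″ ⊕ (l₁ ⊕ y′)))) ⊜ r ⊕ (y ⊕ (l₁ ⊕ (y′ ⊕ (l₂ ⊕ y″)))))
              ↭-refl
              [ y′ ] (ys L₁) [ r ] (ys L₂) [ y ] [ y″ ]
        px : xs ((y , w) ∷ (r , a) ∷ L₂ ++ (y″ , b) ∷ L₁ ++ (y′ , x) ∷ [])
             ↭ x ∷ xs ((y , b) ∷ L₁ ++ (y′ , a) ∷ L₂ ++ (y″ , w) ∷ [])
        px rewrite map-++ proj₂ L₂ ((y″ , b) ∷ L₁ ++ (y′ , x) ∷ [])
                 | map-++ proj₂ L₁ ((y′ , x) ∷ [])
                 | map-++ proj₂ L₁ ((y′ , a) ∷ L₂ ++ (y″ , w) ∷ [])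
                 | map-++ proj₂ L₂ ((y″ , w) ∷ []) =
          solve 6 (λ b l₁ a l₂ x w → w ⊕ (a ⊕ (l₂ ⊕ (b ⊕ (l₁ ⊕ x)))) ⊜ x ⊕ (b ⊕ (l₁ ⊕ (a ⊕ (l₂ ⊕ w)))))
              ↭-refl
              [ b ] (xs L₁) [ a ] (xs L₂) [ x ] [ w ]

      -- The new cycle is x r b ⋯ w y′ v ⋯ a y x, with the arc a ⋯ v reversed.
      fold : ∀ {w y a y′ b r} L₁ {L₂} → Closed w ((y , a) ∷ L₁ ++ (y′ , b) ∷ L₂) →
             Adj x y → Adj w y′ → r ∉ ys Z₀ → Adj x r → ¬ Adj b r
      fold {w} {y} {a} {y′} {b} {r} L₁ {L₂} (closed (cons _ ay p) σ) xy wy′ r∉ xr br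
        with v , p₁ , cons vy′ _ p₂ ← split L₁ p
        with M , q , qy , qx ← reverse p₁ =
        extend σ (cons xr br (p₂ ⧺ cons wy′ vy′ (q ⧺ cons ay xy []))) r∉ py px
        where
        py : ys ((r , b) ∷ L₂ ++ (y′ , v) ∷ M ++ (y , x) ∷ []) ↭ r ∷ ys ((y , a) ∷ L₁ ++ (y′ , b) ∷ L₂)
        py rewrite map-++ proj₁ L₂ ((y′ , v) ∷ M ++ (y , x) ∷ [])
                 | map-++ proj₁ M ((y , x) ∷ []) | map-++ proj₁ L₁ ((y′ , b) ∷ L₂) =
          ↭-trans (prep r (↭.++⁺ˡ (ys L₂) (prep y′ (↭.++⁺ʳ _ qy))))
            (solve 5 (λ y′ l₁ r l₂ y → r ⊕ (l₂ ⊕ (y′ ⊕ (l₁ ⊕ y))) ⊜ r ⊕ (y ⊕ (l₁ ⊕ (y′ ⊕ l₂)))) ↭-refl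
              [ y′ ] (ys L₁) [ r ] (ys L₂) [ y ])
        px : xs ((r , b) ∷ L₂ ++ (y′ , v) ∷ M ++ (y , x) ∷ []) ↭ x ∷ xs ((y , a) ∷ L₁ ++ (y′ , b) ∷ L₂)
        px rewrite map-++ proj₂ L₂ ((y′ , v) ∷ M ++ (y , x) ∷ [])
                 | map-++ proj₂ M ((y , x) ∷ []) | map-++ proj₂ L₁ ((y′ , b) ∷ L₂) =
          ↭-trans (prep b (↭.++⁺ˡ (xs L₂) (↭.++⁺ʳ _ qx)))
            (solve 5 (λ b l₁ a l₂ x → b ⊕ (l₂ ⊕ ((a ⊕ l₁) ⊕ x)) ⊜ x ⊕ (a ⊕ (l₁ ⊕ (b ⊕ l₂)))) ↭-refl
              [ b ] (xs L₁) [ a ] (xs L₂) [ x ])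

      -- At most one neighbour of x on the cycle.

      b∈vs⇒step : ∀ {b Z} → Z ↭ Z₀ → b ∈ vs → ∃[ y ] (y , b) ∈ Z
      b∈vs⇒step σ b∈ with (y , _) , z∈ , refl ← ∈-map⁻ proj₂ (↭.∈-resp-↭ (↭-sym covers) b∈) =
        y , ↭.∈-resp-↭ (↭-sym σ) z∈

      -- Here `inner x` has at most one element, so `Tight` applies with empty `R` to every b whose
      -- outer neighbourhood avoids that of x. This is shown first for w and then, using w, for all
      -- of `vs`; every b in `vs` is then joined to the whole cycle and to everything off it except
      -- `outer x`.
      one-inner : ∀ {w y a L} → Closed w ((y , a) ∷ L) → Adj x y →
                  (∀ {y′} → y′ ∈ ys L → ¬ Adj x y′) → G₂-on δ (x ∷ vs)
      one-inner {w} {y} {a} {L} c@(closed p σ) xy ¬xL = record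
        { A        = vs
        ; B        = [ x ]
        ; hub      = y
        ; P        = ys L ++ outer a
        ; Q        = outer x
        ; vertices = ↭.++-comm vs [ x ]
        ; unique   = Unique-resp-↭ blocks↭ (blocks-unique (sep (⊥-outer a∈vs)))
        ; complete = λ v → ↭.∈-resp-↭ blocks↭ (Tight.complete (sep (⊥-outer a∈vs)) ix≤1 v)
        ; |P|      = trans (cong suc (length-++ (ys L)))
                       (subst (λ k′ → k′ + length (outer a) ≡ δ) (↭.↭-length Ys↭)
                         (Tight.|b| (sep (⊥-outer a∈vs)) ix≤1))
        ; |Q|      = Tight.|a| (sep (⊥-outer a∈vs)) ix≤1
        ; sideA    = (a , a∈vs) , adjA , λ b∈ v∈Q bv → ⊥-outer b∈ (v∈Q , ∈-outer bv (proj₂ (∈-outer⁻ v∈Q)))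
        ; sideB    = (x , here refl)
                   , (λ { (here refl) (here refl) → xy ; (here refl) (there v∈) → proj₁ (∈-outer⁻ v∈) })
                   , λ { (here refl) v∈P xv → xP v∈P xv }
        }
        where
        Ys↭ : ys Z₀ ↭ y ∷ ys L
        Ys↭ = ↭-sym (↭.map⁺ proj₁ σ)

        ix≤1 : length (inner x) ≤ 1
        ix≤1 = ⊆⇒length-≤ {ys = [ y ]} (Uniq.filter⁺ (adj? x) Ys!) only
          where
          only : ∀ {v} → v ∈ inner x → v ∈ [ y ]
          only v∈ with v∈Ys , xv ← ∈-filter⁻ (adj? x) {xs = ys Z₀} v∈ with ↭.∈-resp-↭ Ys↭ v∈Ys
          ... | here refl = here refl
          ... | there v∈L = ⊥-elim (¬xL v∈L xv)

        sep : ∀ {b} → Disjoint (outer x) (outer b) → Separated x b []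
        sep d = record { ab = d ; R! = [] ; R⊥ = λ () }

        w-full : ∀ {y′} → y′ ∈ ys Z₀ → Adj w y′
        w-full = Tight.b-full (sep (λ (r∈x , r∈w) → let xr , r∉ = ∈-outer⁻ r∈x in
                   insert-last c xy r∉ xr (proj₁ (∈-outer⁻ r∈w)))) ix≤1

        -- The successor a of y is handled directly. Any other b follows some y′ on the cycle, and
        -- the edge from w to y′ needed by `fold` comes from `w-full`.
        ⊥-outer : ∀ {b} → b ∈ vs → Disjoint (outer x) (outer b)
        ⊥-outer b∈ (r∈x , r∈b) with xr , r∉ ← ∈-outer⁻ r∈x | br , _ ← ∈-outer⁻ r∈b | b∈vs⇒step σ b∈
        ... | _ , here refl = insert-first c xy r∉ xr br
        ... | y′ , there z∈ with L₁ , L₂ , refl ← ∈-∃++ z∈ =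
          fold L₁ c xy (w-full (↭.∈-resp-↭ (↭-sym Ys↭) (there (∈-map⁺ proj₁ z∈)))) r∉ xr br

        a∈vs : a ∈ vs
        a∈vs = ↭.∈-resp-↭ covers (↭.∈-resp-↭ (↭.map⁺ proj₂ σ) (here refl))

        blocks↭ : blocks x a [] ↭ y ∷ (ys L ++ outer a) ++ outer x
        blocks↭ = ↭-trans (↭.++⁺ʳ (outer x ++ outer a ++ []) Ys↭)
          (solve 4 (λ y l oa ox → (y ⊕ l) ⊕ (ox ⊕ (oa ⊕ ↭-Solver.id)) ⊜ y ⊕ ((l ⊕ oa) ⊕ ox)) ↭-refl
            [ y ] (ys L) (outer a) (outer x))

        in-Ys : ∀ {b v} → b ∈ vs → v ∈ ys Z₀ → Adj b v
        in-Ys b∈ = Tight.b-full (sep (⊥-outer b∈)) ix≤1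

        adjA : ∀ {b v} → b ∈ vs → v ∈ y ∷ ys L ++ outer a → Adj b v
        adjA b∈ (here refl) = in-Ys b∈ (↭.∈-resp-↭ (↭-sym Ys↭) (here refl))
        adjA {b} {v} b∈ (there v∈) with ∈-++⁻ (ys L) v∈
        ... | inj₁ v∈L = in-Ys b∈ (↭.∈-resp-↭ (↭-sym Ys↭) (there v∈L))
        -- By tightness for b, a vertex off the cycle and not in `outer x` lies in `outer b`.
        ... | inj₂ v∈a with ∈-++⁻ (ys Z₀) (Tight.complete (sep (⊥-outer b∈)) ix≤1 v)
        ...   | inj₁ v∈Ys = ⊥-elim (proj₂ (∈-outer⁻ v∈a) v∈Ys)
        ...   | inj₂ q with ∈-++⁻ (outer x) q
        ...     | inj₁ v∈x = ⊥-elim (⊥-outer a∈vs (v∈x , v∈a))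
        ...     | inj₂ q′ with ∈-++⁻ (outer b) q′
        ...       | inj₁ v∈b = proj₁ (∈-outer⁻ v∈b)

        xP : ∀ {v} → v ∈ ys L ++ outer a → ¬ Adj x v
        xP v∈ xv with ∈-++⁻ (ys L) v∈
        ... | inj₁ v∈L = ¬xL v∈L xv
        ... | inj₂ v∈a = ⊥-outer a∈vs (∈-outer xv (proj₂ (∈-outer⁻ v∈a)) , v∈a)

      -- Without a common outer neighbour, `inner-large` would give k < 0 + `length (inner b)`,
      -- which is at most k.
      common-outer : (∀ {y} → y ∈ ys Z₀ → ¬ Adj x y) → ∀ b →
                     ∃[ r ] r ∉ ys Z₀ × Adj x r × Adj b r
      common-outer ¬xYs b with Finₚ.any? (λ r → ¬? (r ∈? ys Z₀) ×-dec adj? x r ×-dec adj? b r)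
      ... | yes found = found
      ... | no none = ⊥-elim (<⇒≱ (inner-large {x} {b} {[]} (record
              { ab = λ { {r} (r∈x , r∈b) →
                       none (r , proj₂ (∈-outer⁻ r∈x) , proj₁ (∈-outer⁻ r∈x) , proj₁ (∈-outer⁻ r∈b)) }
              ; R! = [] ; R⊥ = λ () }))
            (begin
              length (inner x) + length (inner b) ≡⟨ cong (λ l → length l + length (inner b))
                                                       (filter-none (adj? x) (All.tabulate ¬xYs)) ⟩
              length (inner b)                    ≤⟨ inner-≤ b ⟩
              k                                   ≤⟨ m≤m+n k 0 ⟩
              k + 0                               ∎))
        where open ≤-Reasoning

      -- x shares an outer neighbour with each of the consecutive vertices w and a, and `insert`
      -- makes the two coincide. The common r can then replace y on the cycle.
      no-inner : ∀ {w y a L} → Closed w ((y , a) ∷ L) → (∀ {y} → y ∈ ys Z₀ → ¬ Adj x y) →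
                 ∃[ r ] r ∉ ys Z₀ × Adj x r × Adj w r × Adj a r
      no-inner {w} {y} {a} c ¬xYs
        with r , r∉ , xr , wr ← common-outer ¬xYs w
        with r′ , r′∉ , xr′ , ar′ ← common-outer ¬xYs a
        with refl ← insert c r∉ r′∉ wr xr xr′ ar′ = r , r∉ , xr , wr , ar′

      -- Several neighbours of x on the cycle.

      module ManyInner {w₀} (start : Walk w₀ Z₀ w₀) (k<δ : k < δ) where

        inner-step? : (z : Y × X) → Dec (Adj x (proj₁ z))
        inner-step? z = adj? x (proj₁ z)

        -- Whole steps (y , b) are kept, not just the y adjacent to x, because the argument concerns
        -- the successors b.
        D : Steps
        D = filter inner-step? Z₀

        D⁻ : ∀ {z} → z ∈ D → z ∈ Z₀ × Adj x (proj₁ z)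
        D⁻ = ∈-filter⁻ inner-step?

        D⁺ : ∀ {z} → z ∈ Z₀ → Adj x (proj₁ z) → z ∈ D
        D⁺ = ∈-filter⁺ inner-step?

        inner-≤-D : length (inner x) ≤ length D
        inner-≤-D = subst (length (inner x) ≤_) (length-map proj₁ D)
          (⊆⇒length-≤ (Uniq.filter⁺ (adj? x) Ys!) λ v∈ → go (∈-filter⁻ (adj? x) {xs = ys Z₀} v∈))
          where
          go : ∀ {v} → v ∈ ys Z₀ × Adj x v → v ∈ ys D
          go (v∈ , xv) with z , z∈ , refl ← ∈-map⁻ proj₁ v∈ = ∈-map⁺ proj₁ (D⁺ z∈ xv)

        abstract
          -- The cycle has only k < δ vertices in Y, too few to hold all neighbours of `a`.
          has-outer : ∀ a → ∃[ y ] y ∈ outer a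
          has-outer a = nonempty (+-cancelˡ-< k 0 _ (begin-strict
              k + 0                               ≡⟨ +-identityʳ k ⟩
              k                                   <⟨ k<δ ⟩
              δ                                   ≤⟨ inner+outer a ⟩
              length (inner a) + length (outer a) ≤⟨ +-monoˡ-≤ _ (inner-≤ a) ⟩
              k + length (outer a)                ∎))
            where open ≤-Reasoning

        -- An arbitrary choice. The leaves first serve as `R` in the count and finally become the
        -- private neighbours in G₁.
        leaf : X → Y
        leaf a = proj₁ (has-outer a)

        leaf∈ : ∀ a → leaf a ∈ outer a
        leaf∈ a = proj₂ (has-outer a)

        rotate-to : ∀ {z} → z ∈ Z₀ → ∃[ w ] ∃[ L ] Closed w (z ∷ L)
        rotate-to {z} z∈ with Z₁ , Z₂ , eq ← ∈-∃++ z∈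
          with w , c ← rotate Z₁ {z ∷ Z₂} (closed (subst (λ Z → Walk w₀ Z w₀) eq start) (↭-reflexive (sym eq))) =
          w , Z₂ ++ Z₁ , c

        ⊥-x : ∀ {z} → z ∈ D → Disjoint (outer x) (outer (proj₂ z))
        ⊥-x z∈D (r∈x , r∈a) with z∈ , xy ← D⁻ z∈D with w , L , c ← rotate-to z∈ =
          let xr , r∉ = ∈-outer⁻ r∈x in insert-first c xy r∉ xr (proj₁ (∈-outer⁻ r∈a))

        ⊥-pair : ∀ {z z′} → z ∈ D → z′ ∈ D → proj₁ z ≢ proj₁ z′ →
                 Disjoint (outer (proj₂ z)) (outer (proj₂ z′))
        ⊥-pair z∈D z′∈D y≢y′ (r∈b , r∈a) with z∈ , xy ← D⁻ z∈D | z′∈ , xy′ ← D⁻ z′∈D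
          with w , L , c ← rotate-to z∈ with ↭.∈-resp-↭ (↭-sym (Closed.perm c)) z′∈
        ... | here refl = y≢y′ refl
        ... | there z′∈L with L₁ , L₂ , refl ← ∈-∃++ z′∈L =
          let br , r∉ = ∈-outer⁻ r∈b in cross L₁ c xy xy′ r∉ br (proj₁ (∈-outer⁻ r∈a))

        leaves : Steps → List Y
        leaves = map (leaf ∘ proj₂)

        leaves-unique : ∀ {Z} → Unique (ys Z) → (∀ {z} → z ∈ Z → z ∈ D) → Unique (leaves Z)
        leaves-unique Z! sub = map-unique proj₁ (leaf ∘ proj₂) Z! λ {z} {z′} z∈ z′∈ y≢ eq →
          ⊥-pair (sub z∈) (sub z′∈) y≢ (leaf∈ _ , subst (_∈ outer (proj₂ z′)) (sym eq) (leaf∈ _))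

        D! : Unique (ys D)
        D! = map-unique id proj₁ {xs = D}
          (subst Unique (sym (map-id D)) (Uniq.filter⁺ inner-step? (Uniq.map⁻ Ys!)))
          λ z∈ z′∈ z≢z′ eq → z≢z′ (map-unique-injective proj₁ Ys! (proj₁ (D⁻ z∈)) (proj₁ (D⁻ z′∈)) eq)

        -- The count is applied to x and the successor in `z`, with one leaf for every other member
        -- of `D` as `R`. Thus `suc (length R)` is `length D`, which bounds `length (inner x)` as
        -- `Tight` requires.
        module At {z} (z∈D : z ∈ D) where

          abstract
            D′ : Steps
            D′ = proj₁ (∈⇒↭∷ z∈D)

            σ : D ↭ z ∷ D′
            σ = proj₂ (∈⇒↭∷ z∈D)

          D′⊆D : ∀ {z′} → z′ ∈ D′ → z′ ∈ D
          D′⊆D z′∈ = ↭.∈-resp-↭ (↭-sym σ) (there z′∈)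

          separated : Separated x (proj₂ z) (leaves D′)
          separated with y∉ ∷ D′! ← Unique-resp-↭ (↭.map⁺ proj₁ σ) D! = record
            { ab = ⊥-x z∈D
            ; R! = leaves-unique D′! D′⊆D
            ; R⊥ = λ r∈ → go (∈-map⁻ (leaf ∘ proj₂) r∈)
            }
            where
            go : ∀ {r} → ∃[ z′ ] z′ ∈ D′ × r ≡ leaf (proj₂ z′) → r ∉ ys Z₀ × r ∉ outer x × r ∉ outer (proj₂ z)
            go (z′ , z′∈ , refl) =
                proj₂ (∈-outer⁻ (leaf∈ (proj₂ z′)))
              , (λ r∈ → ⊥-x (D′⊆D z′∈) (r∈ , leaf∈ _))
              , (λ r∈ → ⊥-pair z∈D (D′⊆D z′∈) (All.lookup y∉ (∈-map⁺ proj₁ z′∈)) (r∈ , leaf∈ _))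

          open Tight separated
            (≤-trans inner-≤-D (≤-reflexive (trans (↭.↭-length σ) (cong suc (sym (length-map _ D′)))))) public

          -- Off the cycle and `outer x`, `complete` leaves only the outer neighbours of one
          -- successor and the leaves of the others. Either way r is attributed to a member of `D`.
          covering : ∀ r → r ∉ ys Z₀ → r ∉ outer x →
                     ∃[ z′ ] z′ ∈ D × (r ∈ outer (proj₂ z) × z′ ≡ z ⊎ r ≡ leaf (proj₂ z′))
          covering r r∉ r∉x with ∈-++⁻ (ys Z₀) (complete r)
          ... | inj₁ r∈ = ⊥-elim (r∉ r∈)
          ... | inj₂ q with ∈-++⁻ (outer x) q
          ...   | inj₁ r∈ = ⊥-elim (r∉x r∈)
          ...   | inj₂ q′ with ∈-++⁻ (outer (proj₂ z)) q′
          ...     | inj₁ r∈ = z , z∈D , inj₁ (r∈ , refl)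
          ...     | inj₂ r∈ with z′ , z′∈ , eq ← ∈-map⁻ (leaf ∘ proj₂) r∈ = z′ , D′⊆D z′∈ , inj₂ eq

        module _ {z₁ z₂} (z₁∈ : z₁ ∈ D) (z₂∈ : z₂ ∈ D) (y₁≢y₂ : proj₁ z₁ ≢ proj₁ z₂) where

          another : ∀ y → ∃[ z ] z ∈ D × proj₁ z ≢ y
          another y with proj₁ z₁ Fin.≟ y
          ... | yes refl = z₂ , z₂∈ , y₁≢y₂ ∘ sym
          ... | no  y₁≢y = z₁ , z₁∈ , y₁≢y

          covered : ∀ {r} → r ∉ ys Z₀ → ¬ Adj x r → ∃[ z ] z ∈ D × r ∈ outer (proj₂ z)
          covered {r} r∉ ¬xr with At.covering z₁∈ r r∉ (¬xr ∘ proj₁ ∘ ∈-outer⁻)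
          ... | z , z∈ , inj₁ (r∈ , refl) = z , z∈ , r∈
          ... | z , z∈ , inj₂ refl        = z , z∈ , leaf∈ _

          -- Here w lies between the non-member z and the member z′ of `D`. Its leaf r is not
          -- adjacent to x, by `insert-last`, so `covered` makes r an outer neighbour of the
          -- successor in some zᵢ of `D`, and the cycle can be rerouted through r and x.
          at-boundary : ∀ {w z z′ L} → Closed w (z′ ∷ L ++ z ∷ []) → ¬ Adj x (proj₁ z) → Adj x (proj₁ z′) → ⊥
          at-boundary {w} {z} {z′} {L} c@(closed p σ) ¬xz xz′
            with wr , r∉ ← ∈-outer⁻ (leaf∈ w)
            with zᵢ , zᵢ∈D , r∈ ← covered r∉ (λ xr → insert-last c xz′ r∉ xr wr)
            with zᵢ∈ , xzᵢ ← D⁻ zᵢ∈D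
            with ↭.∈-resp-↭ (↭-sym σ) zᵢ∈
          -- When zᵢ is z′ itself, x enters the cycle through z′ and a second member z″ of `D`.
          ... | here refl with z″ , z″∈D , y″≢ ← another (proj₁ z′) with z″∈ , xz″ ← D⁻ z″∈D
              with ↭.∈-resp-↭ (↭-sym σ) z″∈
          ...   | here refl = y″≢ refl
          ...   | there z″∈L with L₁ , L₂ , eq ← ∈-∃++ z″∈L =
            shortcut L₁ (subst (λ M → Closed w (z′ ∷ M)) eq c) xz′ xz″
              (At.b-full z″∈D (∈-map⁺ proj₁ zᵢ∈)) r∉ (proj₁ (∈-outer⁻ r∈)) wr
          at-boundary {w} {z} {z′} {L} c@(closed p σ) ¬xz xz′ | there q with ∈-++⁻ L q
          ...   | inj₂ (here refl) = ¬xz xzᵢ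
          ...   | inj₁ zᵢ∈L with L₁ , L₂ , refl ← ∈-∃++ zᵢ∈L =
            shortcut₂ L₁ L₂ (subst (λ M → Closed w (z′ ∷ M)) (++-assoc L₁ (_ ∷ L₂) _) c) xz′ xzᵢ
              (At.b-full (D⁺ (↭.∈-resp-↭ σ (here refl)) xz′)
                (∈-map⁺ proj₁ (↭.∈-resp-↭ σ (there (∈-++⁺ʳ (L₁ ++ _ ∷ L₂) (here refl))))))
              r∉ (proj₁ (∈-outer⁻ r∈)) wr

          any-inner : ∀ {z L} → ¬ Adj x (proj₁ z) → z ∷ L ↭ Z₀ → Any (Adj x ∘ proj₁) L
          any-inner ¬xz σ with z₁∈Z , xz₁ ← D⁻ z₁∈ with ↭.∈-resp-↭ (↭-sym σ) z₁∈Z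
          ... | here refl  = ⊥-elim (¬xz xz₁)
          ... | there z₁∈L = Any.map (λ { refl → xz₁ }) z₁∈L

          -- Going round from a step outside `D`, `boundary` stops at the first step inside it;
          -- rotating the cycle to begin there gives the situation excluded by `at-boundary`.
          all-inner : ∀ {z} → z ∈ Z₀ → Adj x (proj₁ z)
          all-inner {z} z∈ with adj? x (proj₁ z)
          ... | yes xz = xz
          ... | no ¬xz with w , L , c ← rotate-to z∈
            with as , b , b′ , bs , eq , ¬xb , xb′ ←
              boundary inner-step? z L ¬xz (any-inner ¬xz (Closed.perm c))
            with v , c′ ← rotate (as ++ b ∷ [])
              (subst (Closed w) (trans eq (sym (++-assoc as (b ∷ []) (b′ ∷ bs)))) c) =
            ⊥-elim (at-boundary (subst (λ M → Closed v (b′ ∷ M)) (sym (++-assoc bs as (b ∷ []))) c′) ¬xb xb′)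

          all∈D : ∀ {z} → z ∈ Z₀ → z ∈ D
          all∈D z∈ = D⁺ z∈ (all-inner z∈)

          -- The count made at z₁ shows that the successor in z₂ has no outer neighbour but its
          -- leaf, so its degree is at most k + 1.
          δ≡1+k : suc k ≡ δ
          δ≡1+k = ≤-antisym k<δ (begin
              δ                                   ≤⟨ inner+outer a ⟩
              length (inner a) + length (outer a) ≤⟨ +-mono-≤ (inner-≤ a) |outer| ⟩
              k + 1                               ≡⟨ +-comm k 1 ⟩
              suc k                               ∎)
            where
            open ≤-Reasoning
            a = proj₂ z₂

            only : ∀ {v} → v ∈ outer a → v ∈ [ leaf a ]
            only {v} v∈ with At.covering z₁∈ v (proj₂ (∈-outer⁻ v∈)) (λ v∈x → ⊥-x z₂∈ (v∈x , v∈))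
            ... | _ , _ , inj₁ (v∈₁ , _) = ⊥-elim (⊥-pair z₁∈ z₂∈ y₁≢y₂ (v∈₁ , v∈))
            ... | z , z∈ , inj₂ refl with proj₁ z Fin.≟ proj₁ z₂
            ...   | no y≢y₂ = ⊥-elim (⊥-pair z∈ z₂∈ y≢y₂ (leaf∈ _ , v∈))
            ...   | yes eq with refl ← map-unique-injective proj₁ D! z∈ z₂∈ eq = here refl

            |outer| : length (outer a) ≤ 1
            |outer| = ⊆⇒length-≤ {ys = [ leaf a ]} (outer-unique a) only

          -- Now `D` is the whole cycle: `b-full` joins every successor to all its Y-vertices, while
          -- `⊥-x` and `⊥-pair` make the leaves private.
          many-inner : G₁-on δ (x ∷ vs)
          many-inner = record
            { kernel   = ys Z₀
            ; leaf     = leaf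
            ; unique   = all!
            ; complete = unique-complete all! m≤
            ; |kernel| = δ≡1+k
            ; |vs|     = |x∷vs|
            ; adjᵏ     = adjᵏ
            ; adjˡ     = λ _ → proj₁ (∈-outer⁻ (leaf∈ _))
            ; adjˡ⁻    = adjˡ⁻
            }
            where
            |x∷vs| : length (x ∷ vs) ≡ δ
            |x∷vs| = trans (cong suc (trans (sym (↭.↭-length covers))
              (trans (length-map proj₂ Z₀) (sym (length-map proj₁ Z₀))))) δ≡1+k

            to-D : ∀ {b} → b ∈ vs → ∃[ z ] z ∈ D × proj₂ z ≡ b
            to-D b∈ with y , z∈ ← b∈vs⇒step ↭-refl b∈ = _ , all∈D z∈ , refl

            leaves! : Unique (map leaf vs)
            leaves! = Unique-resp-↭ (↭-trans (↭-reflexive (map-∘ Z₀)) (↭.map⁺ leaf covers))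
              (leaves-unique Ys! all∈D)

            x-leaf∉ : leaf x ∉ map leaf vs
            x-leaf∉ l∈ with b , b∈ , eq ← ∈-map⁻ leaf l∈ with z , z∈ , refl ← to-D b∈ =
              ⊥-x z∈ (leaf∈ x , subst (_∈ outer (proj₂ z)) (sym eq) (leaf∈ _))

            all! : Unique (ys Z₀ ++ map leaf (x ∷ vs))
            all! = Uniq.++⁺ Ys! (∷-unique x-leaf∉ leaves!) λ (v∈ , v∈l) → go v∈ (∈-map⁻ leaf {xs = x ∷ vs} v∈l)
              where
              go : ∀ {v} → v ∈ ys Z₀ → ∃[ a ] a ∈ x ∷ vs × v ≡ leaf a → ⊥
              go v∈ (a , _ , refl) = proj₂ (∈-outer⁻ (leaf∈ a)) v∈

            -- The list has k + δ = 2δ - 1 entries.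
            m≤ : m ≤ length (ys Z₀ ++ map leaf (x ∷ vs))
            m≤ = +-cancelˡ-≤ 1 _ _ (begin
              suc m                                        ≤⟨ m<2δ ⟩
              δ + δ                                        ≡⟨ cong₂ _+_ (sym δ≡1+k)
                                                                (sym (trans (length-map leaf (x ∷ vs)) |x∷vs|)) ⟩
              suc k + length (map leaf (x ∷ vs))           ≡⟨ cong suc (sym (length-++ (ys Z₀))) ⟩
              suc (length (ys Z₀ ++ map leaf (x ∷ vs)))    ∎)
              where open ≤-Reasoning

            adjᵏ : ∀ {a y} → a ∈ x ∷ vs → y ∈ ys Z₀ → Adj a y
            adjᵏ (here refl) y∈ with z , z∈ , refl ← ∈-map⁻ proj₁ y∈ = all-inner z∈
            adjᵏ (there a∈) y∈ with z , z∈ , refl ← to-D a∈ = At.b-full z∈ y∈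

            adjˡ⁻ : ∀ {a b} → a ∈ x ∷ vs → b ∈ x ∷ vs → Adj a (leaf b) → leaf a ≡ leaf b
            adjˡ⁻ (here refl) (here refl) _ = refl
            adjˡ⁻ (here refl) (there b∈) e with z , z∈ , refl ← to-D b∈ =
              ⊥-elim (⊥-x z∈ (∈-outer e (proj₂ (∈-outer⁻ (leaf∈ _))) , leaf∈ _))
            adjˡ⁻ (there a∈) (here refl) e with z , z∈ , refl ← to-D a∈ =
              ⊥-elim (⊥-x z∈ (leaf∈ x , ∈-outer e (proj₂ (∈-outer⁻ (leaf∈ x)))))
            adjˡ⁻ (there a∈) (there b∈) e with z , z∈ , refl ← to-D a∈ | z′ , z′∈ , refl ← to-D b∈
              with proj₁ z Fin.≟ proj₁ z′
            ... | yes eq with refl ← map-unique-injective proj₁ D! z∈ z′∈ eq = refl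
            ... | no y≢ = ⊥-elim (⊥-pair z∈ z′∈ y≢ (∈-outer e (proj₂ (∈-outer⁻ (leaf∈ _))) , leaf∈ _))

    -- Adding a vertex to a G₂.

    complete-walk : ∀ a as P → length as ≤ length P → (∀ {b y} → b ∈ a ∷ as → y ∈ P → Adj b y) →
                    ∃[ L ] ∃[ R ] ∃[ v ] Walk a L v × v ∈ a ∷ as × as ≡ xs L × P ≡ ys L ++ R
    complete-walk a [] P _ _ = [] , P , a , [] , here refl , refl , refl
    complete-walk a (b ∷ as) (y ∷ P) (s≤s le) adj
      with L , R , v , w , v∈ , refl , refl ← complete-walk b as P le (λ c∈ y∈ → adj (there c∈) (there y∈)) =
      (y , b) ∷ L , R , v
      , cons (adj (here refl) (here refl)) (adj (there (here refl)) (here refl)) w , there v∈ , refl , refl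

    -- All neighbours of x, at least δ of them, lie in `hub ∷ P`, which has only δ elements.
    G₂-absorb : ∀ {x vs} (H : G₂-on δ vs) → (∀ {y} → y ∈ G₂-on.Q H → ¬ Adj x y) → G₂-on δ (x ∷ vs)
    G₂-absorb {x} H ¬xQ = record
      { A = x ∷ A ; B = B ; hub = hub ; P = P ; Q = Q
      ; vertices = prep x vertices
      ; unique   = unique
      ; complete = complete
      ; |P| = |P| ; |Q| = |Q|
      ; sideA    = (x , here refl)
                 , (λ { (here refl) → full-filter (adj? x) large ; (there a∈) → proj₁ (proj₂ sideA) a∈ })
                 , λ { (here refl) → ¬xQ ; (there a∈) → proj₂ (proj₂ sideA) a∈ }
      ; sideB    = sideB
      }
      where
      open G₂-on H
      place : ∀ {y} → y ∈ hub ∷ P ++ Q → Adj x y → y ∈ hub ∷ P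
      place {y} y∈ xy with ∈-++⁻ (hub ∷ P) {Q} y∈
      ... | inj₁ y∈P = y∈P
      ... | inj₂ y∈Q = ⊥-elim (¬xQ y∈Q xy)
      large : length (hub ∷ P) ≤ length (filter (adj? x) (hub ∷ P))
      large = ≤-trans (≤-reflexive |P|) (≤-trans (deg x)
        (⊆⇒length-≤ (Uniq.filter⁺ (adj? x) (Uniq.allFin⁺ m)) λ {y} y∈ →
          let xy = proj₂ (∈-filter⁻ (adj? x) {xs = allFin m} y∈) in
          ∈-filter⁺ (adj? x) (place (complete y) xy) xy))

    -- `S` is one side of Y with the neighbour of x removed. What remains must still supply a vertex
    -- for each step of the path through that side.
    other-side-room : ∀ {vs : List X} a as b bs (S : List Y) → (a ∷ as) ++ (b ∷ bs) ↭ vs → suc (length vs) ≤ δ →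
                      suc (suc (length S)) ≡ δ → length as ≤ length S
    other-side-room {vs} a as b bs S σ small |S| = +-cancelˡ-≤ 2 _ _ (begin
      suc (suc (length as))                   ≤⟨ s≤s (s≤s (m≤m+n (length as) _)) ⟩
      suc (suc (length as + length bs))       ≡⟨ cong suc (+-suc (length as) (length bs)) ⟨
      suc (length as + length (b ∷ bs))       ≡⟨ cong suc (length-++ as) ⟨
      length ((a ∷ as) ++ (b ∷ bs))           ≡⟨ ↭.↭-length σ ⟩
      length vs                               ≤⟨ n≤1+n _ ⟩
      suc (length vs)                         ≤⟨ small ⟩
      δ                                       ≡⟨ |S| ⟨
      suc (suc (length S))                    ∎)
      where open ≤-Reasoning

    -- The cycle is x p a ⋯ v `hub` b ⋯ w q x. Both arcs lie in complete bipartite graphs, so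
    -- `complete-walk` can visit all of A and all of B in the order given.
    join-sides : ∀ {x vs A B hub P Q p q} → A ++ B ↭ vs → Unique (hub ∷ P ++ Q) →
                 suc (length P) ≡ δ → suc (length Q) ≡ δ → G₂-side A hub P Q → G₂-side B hub Q P →
                 suc (length vs) ≤ δ → p ∈ P → q ∈ Q → Adj x p → Adj x q → CycleOn (x ∷ vs)
    join-sides {A = []} _ _ _ _ ((_ , ()) , _)
    join-sides {A = _ ∷ _} {B = []} _ _ _ _ _ ((_ , ()) , _)
    join-sides {x} {vs} {a ∷ as} {b ∷ bs} {hub} {P} {Q} {p} {q} σ Y! |P| |Q|
               (_ , adjA , _) (_ , adjB , _) small p∈ q∈ xp xq
      with P′ , σᴾ ← ∈⇒↭∷ p∈ | Q′ , σᑫ ← ∈⇒↭∷ q∈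
      with Lᵃ , Rᵃ , v , wᵃ , v∈ , refl , refl ← complete-walk a as P′
             (other-side-room a as b bs P′ σ small (trans (cong suc (sym (↭.↭-length σᴾ))) |P|))
             (λ c∈ y∈ → adjA c∈ (there (↭.∈-resp-↭ (↭-sym σᴾ) (there y∈))))
         | Lᵇ , Rᵇ , w , wᵇ , w∈ , refl , refl ← complete-walk b bs Q′
             (other-side-room b bs a as Q′ (↭-trans (↭.++-comm (b ∷ bs) (a ∷ as)) σ) small
               (trans (cong suc (sym (↭.↭-length σᑫ))) |Q|))
             (λ c∈ y∈ → adjB c∈ (there (↭.∈-resp-↭ (↭-sym σᑫ) (there y∈)))) =
      cycleOn
        (cons xp (adjA (here refl) (there p∈)) (wᵃ ⧺ cons (adjA v∈ (here refl)) (adjB (here refl) (here refl))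
          (wᵇ ⧺ cons (adjB w∈ (there q∈)) xq [])))
        -- `Rᵃ` and `Rᵇ` are the vertices of Y that the cycle leaves out.
        (++-uniqueˡ (ys Z) (Unique-resp-↭ py Y!))
        (↭-trans px (prep x σ))
      where
      open ↭-Solver using (solve; _⊕_; _⊜_)

      Z = (p , a) ∷ Lᵃ ++ (hub , b) ∷ Lᵇ ++ (q , x) ∷ []

      py : hub ∷ P ++ Q ↭ ys Z ++ (Rᵃ ++ Rᵇ)
      py rewrite map-++ proj₁ Lᵃ ((hub , b) ∷ Lᵇ ++ (q , x) ∷ []) | map-++ proj₁ Lᵇ ((q , x) ∷ []) =
        ↭-trans (prep hub (↭.++⁺ σᴾ σᑫ))
          (solve 7 (λ h p la ra q lb rb → h ⊕ ((p ⊕ (la ⊕ ra)) ⊕ (q ⊕ (lb ⊕ rb)))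
                                     ⊜ (p ⊕ (la ⊕ (h ⊕ (lb ⊕ q)))) ⊕ (ra ⊕ rb)) ↭-refl
            [ hub ] [ p ] (ys Lᵃ) Rᵃ [ q ] (ys Lᵇ) Rᵇ)

      px : xs Z ↭ x ∷ (a ∷ xs Lᵃ) ++ (b ∷ xs Lᵇ)
      px rewrite map-++ proj₂ Lᵃ ((hub , b) ∷ Lᵇ ++ (q , x) ∷ []) | map-++ proj₂ Lᵇ ((q , x) ∷ []) =
        solve 5 (λ x a la b lb → a ⊕ (la ⊕ (b ⊕ (lb ⊕ x))) ⊜ x ⊕ ((a ⊕ la) ⊕ (b ⊕ lb))) ↭-refl
          [ x ] [ a ] (xs Lᵃ) [ b ] (xs Lᵇ)

    extend-G₂ : ∀ {x vs} → suc (length vs) ≤ δ → ¬ CycleOn (x ∷ vs) → G₂-on δ vs → G₂-on δ (x ∷ vs)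
    extend-G₂ {x} small acyclic H with Any.any? (adj? x) (G₂-on.P H) | Any.any? (adj? x) (G₂-on.Q H)
    ... | _ | no ¬xQ = G₂-absorb H λ y∈ xy → ¬xQ (Any.map (λ { refl → xy }) y∈)
    ... | no ¬xP | yes _ = G₂-absorb (G₂-swap H) λ y∈ xy → ¬xP (Any.map (λ { refl → xy }) y∈)
    ... | yes xP | yes xQ with p , p∈ , xp ← find xP | q , q∈ , xq ← find xQ =
      ⊥-elim (acyclic (join-sides vertices unique |P| |Q| sideA sideB small p∈ q∈ xp xq))
      where open G₂-on H

    -- The induction on the number of vertices.

    extend-cycle : ∀ {x v vs} → suc (length (v ∷ vs)) ≤ δ → ¬ CycleOn (x ∷ v ∷ vs) → CycleOn (v ∷ vs) →
                   G₂-on δ (x ∷ v ∷ vs) ⊎ G₁-on δ (x ∷ v ∷ vs)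
    extend-cycle _ _ (cycleOn {steps = []} _ _ covers) = ⊥-elim (↭.¬x∷xs↭[] (↭-sym covers))
    extend-cycle {x} {v} {vs} small acyclic (cycleOn {w} {Z@((y , a) ∷ L)} p@(cons _ _ q) Z! covers)
      with Any.any? (adj? x ∘ proj₁) Z
    ... | no none
      with ¬xZ ← (λ {y} (y∈ : y ∈ ys Z) xy → none (Any.map (λ { refl → xy }) (Anyₚ.map⁻ y∈)))
      with r , r∉ , xr , wr , ar ← Reroute.no-inner acyclic Z! covers (Reroute.closed p ↭-refl) ¬xZ =
      -- In the cycle with r in place of y, the only neighbour of x is r.
      inj₁ (Reroute.one-inner acyclic (∷-unique (r∉ ∘ there) (AllPairs.tail Z!)) covers
        (Reroute.closed (cons wr ar q) ↭-refl) xr (¬xZ ∘ there))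
    ... | yes some
      with k<δ ← subst (_< δ) (trans (sym (↭.↭-length covers))
                   (trans (length-map proj₂ Z) (sym (length-map proj₁ Z)))) small
      with z , z∈ , xz ← find some
      -- The cycle is rotated to start at a neighbour of x; whether there is another one in the rest
      -- decides between G₂ and G₁.
      with w′ , L′ , c@(Reroute.closed _ σ) ← Reroute.ManyInner.rotate-to acyclic Z! covers p k<δ z∈
      with Any.any? (adj? x ∘ proj₁) L′
    ...   | no none = inj₁ (Reroute.one-inner acyclic Z! covers c xz
              λ y∈ xy → none (Any.map (λ { refl → xy }) (Anyₚ.map⁻ y∈)))
    ...   | yes some′ with z′ , z′∈ , xz′ ← find some′ = inj₂
              (many-inner (D⁺ z∈ xz) (D⁺ (↭.∈-resp-↭ σ (there z′∈)) xz′)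
              (All.lookup (AllPairs.head (Unique-resp-↭ (↭-sym (↭.map⁺ proj₁ σ)) Z!)) (∈-map⁺ proj₁ z′∈)))
      where open Reroute.ManyInner acyclic Z! covers p k<δ

    -- Whether a larger cycle exists is decided first, so that both extension lemmas may assume
    -- there is none.
    grow : ∀ {x v vs} → suc (length (v ∷ vs)) ≤ δ →
           CycleOn (v ∷ vs) ⊎ G₂-on δ (v ∷ vs) ⊎ G₁-on δ (v ∷ vs) →
           CycleOn (x ∷ v ∷ vs) ⊎ G₂-on δ (x ∷ v ∷ vs) ⊎ G₁-on δ (x ∷ v ∷ vs)
    grow {x} {v} {vs} small H with cycleOn? (x ∷ v ∷ vs)
    ... | yes c = inj₁ c
    ... | no acyclic with H
    ...   | inj₁ c         = inj₂ (extend-cycle small acyclic c)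
    ...   | inj₂ (inj₁ H₂) = inj₂ (inj₁ (extend-G₂ small acyclic H₂))
    ...   | inj₂ (inj₂ H₁) = ⊥-elim (<-irrefl (G₁-on.|vs| H₁) small)

    classify : ∀ vs → 1 ≤ length vs → length vs ≤ δ → CycleOn vs ⊎ G₂-on δ vs ⊎ G₁-on δ vs
    classify [] ()
    classify (v ∷ []) _ small with y , y∈ ← nonempty (≤-trans small (deg v))
      with vy ← proj₂ (∈-filter⁻ (adj? v) {xs = allFin m} y∈) =
      inj₁ (cycleOn (cons vy vy []) ([] ∷ []) ↭-refl)
    classify (x ∷ v ∷ vs) _ small = grow small (classify (v ∷ vs) (s≤s z≤n) (<⇒≤ small))

  -- From closed walks to cycles of length 2n.

  open Graph (graph G) using () renaming (_~_ to _∼_)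

  -- Each step contributes its Y-vertex and then its endpoint. The base of a closed walk therefore
  -- comes last, and the closing edge leads from it to the first Y-vertex.
  vertices : Steps → List (X ⊎ Y)
  vertices []            = []
  vertices ((y , w) ∷ L) = inj₂ y ∷ inj₁ w ∷ vertices L

  length-vertices : ∀ L → length (vertices L) ≡ 2 * length L
  length-vertices []      = refl
  length-vertices (_ ∷ L) = trans (cong (2 +_) (length-vertices L)) (sym (*-suc 2 (length L)))

  vertices-ys : ∀ {y} L → inj₂ y ∈ vertices L → y ∈ ys L
  vertices-ys (_ ∷ L) (here refl)        = here refl
  vertices-ys (_ ∷ L) (there (there y∈)) = there (vertices-ys L y∈)

  vertices-xs : ∀ {x} L → inj₁ x ∈ vertices L → x ∈ xs L
  vertices-xs (_ ∷ L) (there (here refl)) = here refl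
  vertices-xs (_ ∷ L) (there (there x∈))  = there (vertices-xs L x∈)

  vertices-unique : ∀ L → Unique (ys L) → Unique (xs L) → Unique (vertices L)
  vertices-unique []      _        _        = []
  vertices-unique ((y , w) ∷ L) (y∉ ∷ Y!) (w∉ ∷ X!) =
    ∷-unique (λ { (there y∈) → All.lookup y∉ (vertices-ys L y∈) refl })
      (∷-unique (λ w∈ → All.lookup w∉ (vertices-xs L w∈) refl) (vertices-unique L Y! X!))

  walk-first : ∀ {u L v} → Walk u L v → ∀ j → toℕ j ≡ 0 → inj₁ u ∼ lookup (vertices L) j
  walk-first (cons uy _ _) zero _ = uy

  walk-last : ∀ {u L v} → Walk u L v → ∀ i → suc (toℕ i) ≡ length (vertices L) →
              lookup (vertices L) i ≡ inj₁ v
  walk-last (cons _ _ []) (suc zero) _ = refl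
  walk-last (cons _ _ p@(cons _ _ _)) (suc (suc i)) eq =
    walk-last p i (suc-injective (suc-injective eq))

  walk-step : ∀ {u L v} → Walk u L v → ∀ i j → toℕ j ≡ suc (toℕ i) →
              lookup (vertices L) i ∼ lookup (vertices L) j
  walk-step (cons _ wy p) zero          (suc zero)    _  = wy
  walk-step (cons _ _ p)  (suc zero)    (suc (suc j)) eq = walk-first p j (suc-injective (suc-injective eq))
  walk-step (cons _ _ p)  (suc (suc i)) (suc (suc j)) eq = walk-step p i j (suc-injective (suc-injective eq))

  hamiltonian : n ≥ 2 → CycleOn (allFin n) → Cycle (graph G) (2 * n)
  hamiltonian n≥2 (cycleOn {steps = L} p Y! covers) = subst (Cycle (graph G)) |vertices| record
    -- Here n ≥ 2 rules out an edge traversed back and forth.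
    { 3≤k       = subst (3 ≤_) (sym |vertices|) (≤-trans (n≤1+n 3) (*-monoʳ-≤ 2 n≥2))
    ; vertex    = lookup (vertices L)
    ; injective = lookup-injective (vertices-unique L Y! (Unique-resp-↭ (↭-sym covers) (Uniq.allFin⁺ n)))
    ; step      = walk-step p
    ; close     = λ i j last first →
        subst (_∼ lookup (vertices L) j) (sym (walk-last p i last)) (walk-first p j first)
    }
    where
    |vertices| : length (vertices L) ≡ 2 * n
    |vertices| = trans (length-vertices L) (cong (2 *_)
      (trans (sym (length-map proj₂ L)) (trans (↭.↭-length covers) (length-tabulate {n = n} id))))

  -- Isomorphisms with G₁ and G₂.

  ≅G₁ : ∀ {δ} → G₁-on δ (allFin n) → δ ≡ n × graph G ≅ graph (G₁ δ)
  ≅G₁ {δ} H with refl ← trans (sym (length-tabulate {n = n} id)) (G₁-on.|vs| H) =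
    refl , ≅-sym (bipartite-iso {G = G₁ n} {H = G} id g id (λ x → x , refl) g-inj (g-surj ∘ complete) adj)
    where
    open G₁-on H

    position : Fin (δ ∸ 1) → Fin (length kernel)
    position = Fin.cast (sym (cong pred |kernel|))

    g : Y₁ δ → Y
    g (core j)              = lookup kernel (position j)
    g (private-neighbour i) = leaf i

    core≢leaf : ∀ {i j} → lookup kernel (position j) ≢ leaf i
    core≢leaf {i} {j} eq = ++-disjoint kernel unique
      (subst (_∈ kernel) eq (∈-lookup (position j)) , ∈-map⁺ leaf (∈-allFin i))

    leaf-injective : ∀ {i j} → leaf i ≡ leaf j → i ≡ j
    leaf-injective = map-unique-injective leaf (++-uniqueʳ kernel unique) (∈-allFin _) (∈-allFin _)

    g-inj : Injective _≡_ _≡_ g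
    g-inj {core i} {core j} eq = cong core (cast-injective (lookup-injective (++-uniqueˡ kernel unique) eq))
    g-inj {core i} {private-neighbour j} eq = ⊥-elim (core≢leaf eq)
    g-inj {private-neighbour i} {core j} eq = ⊥-elim (core≢leaf (sym eq))
    g-inj {private-neighbour i} {private-neighbour j} eq = cong private-neighbour (leaf-injective eq)

    g-surj : ∀ {y} → y ∈ kernel ++ map leaf (allFin n) → ∃[ u ] g u ≡ y
    g-surj y∈ with ∈-++⁻ kernel y∈
    ... | inj₁ y∈k with i , refl ← lookup-surjective y∈k =
      core (Fin.cast (cong pred |kernel|) i)
      , cong (lookup kernel) (Finₚ.cast-involutive (sym (cong pred |kernel|)) (cong pred |kernel|) i)
    ... | inj₂ y∈l with i , _ , refl ← ∈-map⁻ leaf y∈l = private-neighbour i , refl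

    adj : ∀ x y → BipartiteGraph.Adj (G₁ δ) x y ⇔ Adj x (g y)
    adj x (core j) = mk⇔ (λ _ → adjᵏ (∈-allFin x) (∈-lookup (position j))) (λ _ → tt)
    adj x (private-neighbour i) = mk⇔ (λ { refl → adjˡ (∈-allFin x) })
      (λ e → leaf-injective (adjˡ⁻ (∈-allFin x) (∈-allFin i) e))

  ≅G₂ : ∀ {δ} (H : G₂-on δ (allFin n)) → graph G ≅ graph (G₂ δ (length (G₂-on.A H)) (length (G₂-on.B H)))
  ≅G₂ {δ} H = ≅-sym (bipartite-iso f g f-inj (λ x → f-surj (↭.∈-resp-↭ (↭-sym vertices′) (∈-allFin x)))
                       g-inj (g-surj ∘ complete) adj)
    where
    open G₂-on H renaming (vertices to vertices′)

    f : Fin (length A) ⊎ Fin (length B) → X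
    f (inj₁ i) = lookup A i
    f (inj₂ j) = lookup B j

    AB! : Unique (A ++ B)
    AB! = Unique-resp-↭ (↭-sym vertices′) (Uniq.allFin⁺ n)

    A≢B : ∀ {i j} → lookup A i ≢ lookup B j
    A≢B {i} {j} eq = ++-disjoint A AB! (∈-lookup i , subst (_∈ B) (sym eq) (∈-lookup j))

    f-inj : Injective _≡_ _≡_ f
    f-inj {inj₁ i} {inj₁ j} eq = cong inj₁ (lookup-injective {xs = A} (++-uniqueˡ A AB!) eq)
    f-inj {inj₁ i} {inj₂ j} eq = ⊥-elim (A≢B eq)
    f-inj {inj₂ i} {inj₁ j} eq = ⊥-elim (A≢B (sym eq))
    f-inj {inj₂ i} {inj₂ j} eq = cong inj₂ (lookup-injective (++-uniqueʳ A AB!) eq)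

    f-surj : ∀ {x} → x ∈ A ++ B → ∃[ u ] f u ≡ x
    f-surj x∈ with ∈-++⁻ A x∈
    ... | inj₁ x∈A with i , eq ← lookup-surjective x∈A = inj₁ i , eq
    ... | inj₂ x∈B with i , eq ← lookup-surjective x∈B = inj₂ i , eq

    inP : Fin (δ ∸ 1) → Fin (length P)
    inP = Fin.cast (sym (cong pred |P|))

    inQ : Fin (δ ∸ 1) → Fin (length Q)
    inQ = Fin.cast (sym (cong pred |Q|))

    g : Y₂ δ → Y
    g shared    = hub
    g (only₁ i) = lookup P (inP i)
    g (only₂ i) = lookup Q (inQ i)

    PQ! : Unique (P ++ Q)
    PQ! = AllPairs.tail unique

    hub≢P : ∀ {i} → hub ≢ lookup P i
    hub≢P {i} = All.lookup (AllPairs.head unique) (∈-++⁺ˡ {xs = P} (∈-lookup i))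

    hub≢Q : ∀ {i} → hub ≢ lookup Q i
    hub≢Q {i} = All.lookup (AllPairs.head unique) (∈-++⁺ʳ P (∈-lookup i))

    P≢Q : ∀ {i j} → lookup P i ≢ lookup Q j
    P≢Q {i} {j} eq = ++-disjoint P PQ! (∈-lookup i , subst (_∈ Q) (sym eq) (∈-lookup j))

    g-inj : Injective _≡_ _≡_ g
    g-inj {shared}  {shared}  _  = refl
    g-inj {shared}  {only₁ _} eq = ⊥-elim (hub≢P eq)
    g-inj {shared}  {only₂ _} eq = ⊥-elim (hub≢Q eq)
    g-inj {only₁ _} {shared}  eq = ⊥-elim (hub≢P (sym eq))
    g-inj {only₁ _} {only₁ _} eq = cong only₁ (cast-injective (lookup-injective {xs = P} (++-uniqueˡ P PQ!) eq))
    g-inj {only₁ _} {only₂ _} eq = ⊥-elim (P≢Q eq)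
    g-inj {only₂ _} {shared}  eq = ⊥-elim (hub≢Q (sym eq))
    g-inj {only₂ _} {only₁ _} eq = ⊥-elim (P≢Q (sym eq))
    g-inj {only₂ _} {only₂ _} eq = cong only₂ (cast-injective (lookup-injective (++-uniqueʳ P PQ!) eq))

    g-surj : ∀ {y} → y ∈ hub ∷ P ++ Q → ∃[ u ] g u ≡ y
    g-surj (here refl) = shared , refl
    g-surj (there y∈) with ∈-++⁻ P y∈
    ... | inj₁ y∈P with i , refl ← lookup-surjective y∈P =
      only₁ (Fin.cast (cong pred |P|) i)
      , cong (lookup P) (Finₚ.cast-involutive (sym (cong pred |P|)) (cong pred |P|) i)
    ... | inj₂ y∈Q with i , refl ← lookup-surjective y∈Q =
      only₂ (Fin.cast (cong pred |Q|) i)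
      , cong (lookup Q) (Finₚ.cast-involutive (sym (cong pred |Q|)) (cong pred |Q|) i)

    adj : ∀ x y → BipartiteGraph.Adj (G₂ δ (length A) (length B)) x y ⇔ Adj (f x) (g y)
    adj (inj₁ i) shared    = mk⇔ (λ _ → proj₁ (proj₂ sideA) (∈-lookup i) (here refl)) (λ _ → tt)
    adj (inj₁ i) (only₁ j) = mk⇔ (λ _ → proj₁ (proj₂ sideA) (∈-lookup i) (there (∈-lookup (inP j)))) (λ _ → tt)
    adj (inj₁ i) (only₂ j) = mk⇔ ⊥-elim (proj₂ (proj₂ sideA) (∈-lookup i) (∈-lookup (inQ j)))
    adj (inj₂ i) shared    = mk⇔ (λ _ → proj₁ (proj₂ sideB) (∈-lookup i) (here refl)) (λ _ → tt)
    adj (inj₂ i) (only₁ j) = mk⇔ ⊥-elim (proj₂ (proj₂ sideB) (∈-lookup i) (∈-lookup (inP j)))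
    adj (inj₂ i) (only₂ j) = mk⇔ (λ _ → proj₁ (proj₂ sideB) (∈-lookup i) (there (∈-lookup (inQ j)))) (λ _ → tt)

  side-nonempty : ∀ {A s P Q} → G₂-side A s P Q → length A ≥ 1
  side-nonempty {_ ∷ _} _             = s≤s z≤n
  side-nonempty {[]}    ((_ , ()) , _)

  is-G₂ : ∀ {δ} (H : G₂-on δ (allFin n)) → length (G₂-on.A H) ≥ length (G₂-on.B H) →
          ∃[ a ] ∃[ b ] (a ≥ 1 × b ≥ 1 × a ≥ b × a + b ≡ n × graph G ≅ graph (G₂ δ a b))
  is-G₂ H a≥b = length A , length B , side-nonempty sideA , side-nonempty sideB , a≥b
    , trans (sym (length-++ A)) (trans (↭.↭-length vertices′) (length-tabulate id)) , ≅G₂ H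
    where open G₂-on H renaming (vertices to vertices′)

  extremal : ∀ {δ} → n ≥ 2 → δ ≥ n → m < δ + δ → (∀ x → degree G x ≥ δ) → ¬ Cycle (graph G) (2 * n) →
             (δ ≡ n × graph G ≅ graph (G₁ δ))
             ⊎ (∃[ a ] ∃[ b ] (a ≥ 1 × b ≥ 1 × a ≥ b × a + b ≡ n × graph G ≅ graph (G₂ δ a b)))
  extremal {δ} n≥2 δ≥n m<2δ deg acyclic
    with |all| ← length-tabulate {n = n} id
    with Bounds.classify δ m<2δ (λ x → subst (δ ≤_) (degree≡|N| x) (deg x)) (allFin n)
           (subst (1 ≤_) (sym |all|) (<⇒≤ n≥2)) (subst (_≤ δ) (sym |all|) δ≥n)
  ... | inj₁ c = ⊥-elim (acyclic (hamiltonian n≥2 c))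
  ... | inj₂ (inj₂ H) = inj₁ (≅G₁ H)
  ... | inj₂ (inj₁ H) with ≤-total (length (G₂-on.B H)) (length (G₂-on.A H))
  ...   | inj₁ a≥b = inj₂ (is-G₂ H a≥b)
  -- The two sides are interchangeable, so the larger one can be put first.
  ...   | inj₂ b≥a = inj₂ (is-G₂ (G₂-swap H) b≥a)

theorem3 : (n m δ : ℕ) → n ≥ 2 → δ ≥ n → m ≤ 2 * δ ∸ 1 →
    (G : BipartiteGraph (Fin n) (Fin m)) →
    (∀ x → degree G x ≥ δ) →
    ¬ Cycle (graph G) (2 * n) →
    (δ ≡ n × graph G ≅ graph (G₁ δ))
    ⊎ (∃[ a ] ∃[ b ] (a ≥ 1 × b ≥ 1 × a ≥ b × a + b ≡ n
    × graph G ≅ graph (G₂ δ a b)))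
-- For positive δ the truncated subtraction computes, and `s≤s m≤` bounds m strictly by δ + (δ + 0).
theorem3 n m δ@(suc _) n≥2 δ≥n m≤ G =
  Walks.extremal G n≥2 δ≥n (subst (λ d → m < δ + d) (+-identityʳ δ) (s≤s m≤))
theorem3 n m zero n≥2 δ≥n = ⊥-elim (<⇒≱ n≥2 (≤-trans δ≥n z≤n))
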